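{- For all integers $n\ge 0$ and $\alpha>0$, $$v_0(2^{2\alpha+2}n)\equiv \begin{cases}1 \pmod{2^{3\alpha+2}}, & \text{if } n=k^2 \text{ for some integer } k,\\ 0 \pmod{2^{3\alpha+2}}, & \text{otherwise.}\end{cases}$$
   Context: The integer sequence $v_0(n)$, $n\ge 0$, is defined by the generating function (formal power series in $q$) $$\sum_{n=0}^\infty v_0(n)q^n=\sum_{n=0}^\infty \frac{q^{n^2}(-q;q^2)_n}{(q;q^2)_n},$$ where $(a;q)_0=1$ and $(a;q)_n=\prod_{i=1}^n(1-aq^{i-1})$ for $n\ge1$, so that $(-q;q^2)_n=\prod_{i=1}^n(1+q^{2i-1})$ and $(q;q^2)_n=\prod_{i=1}^n(1-q^{2i-1})$. -}

module Defs where

open import Data.Nat as ℕ using (ℕ; zero; suc; z≤n; s≤s)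
import Data.Nat.Properties as ℕ
open import Data.Fin using (toℕ)
open import Data.Integer using (ℤ; +_; 0ℤ; 1ℤ; _+_; _-_; _*_; -_)
open import Data.Integer.Properties
open import Data.Integer.Divisibility.Signed using (_∣_)
open import Data.Product using (_,_; ∃; ∃-syntax)
open import Algebra.Properties.Monoid.Sum +-0-monoid public using (sum-syntax)
open import Function using (_∘_)
open import Relation.Binary.PropositionalEquality

-- Formal power series over ℤ: f n is the coefficient of qⁿ.
PowerSeries : Set
PowerSeries = ℕ → ℤ

infix  8 -ₛ_
infixr 8 _^ₛ_
infixl 7 _*ₛ_ _/ₛ_
infixl 6 _-ₛ_

1ₛ : PowerSeries
1ₛ zero    = 1ℤ
1ₛ (suc _) = 0ℤ

q : PowerSeries
q zero          = 0ℤ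
q (suc zero)    = 1ℤ
q (suc (suc _)) = 0ℤ

-ₛ_ : PowerSeries → PowerSeries
(-ₛ f) n = - f n

_-ₛ_ : PowerSeries → PowerSeries → PowerSeries
(f -ₛ g) n = f n - g n

_*ₛ_ : PowerSeries → PowerSeries → PowerSeries
(f *ₛ g) n = ∑[ i < suc n ] (f (toℕ i) * g (n ℕ.∸ toℕ i))

_^ₛ_ : PowerSeries → ℕ → PowerSeries
f ^ₛ zero  = 1ₛ
f ^ₛ suc n = f *ₛ f ^ₛ n

-- Long division, meaningful only when g has constant term 1 (see /ₛ-*ₛ):
-- f / g = f(0) + q · (((f - f(0) g) / q) / g).
_/ₛ_ : PowerSeries → PowerSeries → PowerSeries
(f /ₛ g) zero    = f zero
(f /ₛ g) (suc n) = ((λ m → f (suc m) - f zero * g (suc m)) /ₛ g) n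

-- (a ; b)ₙ = ∏_{i=1}^{n} (1 - a bⁱ⁻¹)
poch : PowerSeries → PowerSeries → ℕ → PowerSeries
poch a b zero    = 1ₛ
poch a b (suc n) = poch a b n *ₛ (1ₛ -ₛ a *ₛ b ^ₛ n)

term : ℕ → PowerSeries
term n = (q ^ₛ (n ℕ.* n) *ₛ poch (-ₛ q) (q ^ₛ 2) n) /ₛ poch q (q ^ₛ 2) n

-- The n-th term is divisible by q^(n²), so only the terms with n ≤ N
-- contribute to the coefficient of q^N; see v₀-isSum.
v₀ : ℕ → ℤ
v₀ N = ∑[ n < suc N ] term (toℕ n) N

infix 4 _≡_[mod_]

_≡_[mod_] : ℤ → ℤ → ℕ → Set
a ≡ b [mod m ] = + m ∣ a - b

IsSquare : ℕ → Set
IsSquare n = ∃[ k ] + n ≡ k * k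

/ₛ-*ₛ : ∀ f g → g 0 ≡ 1ℤ → (f /ₛ g) *ₛ g ≗ f
/ₛ-*ₛ f g g₀ zero = begin
  f 0 * g 0 + 0ℤ  ≡⟨ +-identityʳ _ ⟩
  f 0 * g 0       ≡⟨ cong (f 0 *_) g₀ ⟩
  f 0 * 1ℤ        ≡⟨ *-identityʳ _ ⟩
  f 0             ∎
  where open ≡-Reasoning
/ₛ-*ₛ f g g₀ (suc n) = begin
  a + ((f′ /ₛ g) *ₛ g) n   ≡⟨ cong (_+_ a) (/ₛ-*ₛ f′ g g₀ n) ⟩
  a + (f (suc n) - a)      ≡⟨ +-comm a _ ⟩
  (f (suc n) - a) + a      ≡⟨ +-assoc (f (suc n)) (- a) a ⟩
  f (suc n) + (- a + a)    ≡⟨ cong (_+_ (f (suc n))) (+-inverseˡ a) ⟩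
  f (suc n) + 0ℤ           ≡⟨ +-identityʳ _ ⟩
  f (suc n)                ∎
  where
  open ≡-Reasoning
  a : ℤ
  a = f 0 * g (suc n)
  f′ : PowerSeries
  f′ m = f (suc m) - f 0 * g (suc m)

poch-q-constant : ∀ b n → poch q b n 0 ≡ 1ℤ
poch-q-constant b zero    = refl
poch-q-constant b (suc n) = cong (λ x → x * 1ℤ + 0ℤ) (poch-q-constant b n)

-- Convergence of ∑ₙ F n to s in the q-adic topology: every coefficient of the
-- partial sums is eventually that of s.
IsSum : (ℕ → PowerSeries) → PowerSeries → Set
IsSum F s = ∀ N → ∃[ M ] (∀ m → M ℕ.≤ m → ∑[ n < m ] F (toℕ n) N ≡ s N)

private
  VanishesBelow : ℕ → PowerSeries → Set
  VanishesBelow k f = ∀ {i} → i ℕ.< k → f i ≡ 0ℤ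

  *ₛ-vanishes : ∀ k f g → VanishesBelow k f → VanishesBelow k (f *ₛ g)
  *ₛ-vanishes k f g f≈0 {zero}  i<k = cong (λ x → x * g 0 + 0ℤ) (f≈0 i<k)
  *ₛ-vanishes (suc k) f g f≈0 {suc i} (s≤s i<k) = cong₂ (λ x y → x * g (suc i) + y)
    (f≈0 (s≤s z≤n)) (*ₛ-vanishes k (f ∘ suc) g (λ j<k → f≈0 (s≤s j<k)) i<k)

  /ₛ-vanishes : ∀ k f g → VanishesBelow k f → VanishesBelow k (f /ₛ g)
  /ₛ-vanishes k f g f≈0 {zero} i<k = f≈0 i<k
  /ₛ-vanishes (suc k) f g f≈0 {suc i} (s≤s i<k) = /ₛ-vanishes k _ g
    (λ {j} j<k → cong₂ (λ x y → x - y * g (suc j)) (f≈0 (s≤s j<k)) (f≈0 (s≤s z≤n))) i<k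

  q^-vanishes : ∀ k → VanishesBelow k (q ^ₛ k)
  q^-vanishes (suc k) {zero}  _ = refl
  q^-vanishes (suc k) {suc i} (s≤s i<k) = trans (+-identityˡ _) (shift i i<k)
    where
    zeros : ∀ (h : PowerSeries) n → ((λ _ → 0ℤ) *ₛ h) n ≡ 0ℤ
    zeros h n = *ₛ-vanishes (suc n) (λ _ → 0ℤ) h (λ _ → refl) ℕ.≤-refl
    shift : ∀ i → i ℕ.< k → ((q ∘ suc) *ₛ (q ^ₛ k)) i ≡ 0ℤ
    shift zero    i<k = cong (λ x → 1ℤ * x + 0ℤ) (q^-vanishes k i<k)
    shift (suc i) i<k = cong₂ (λ x y → 1ℤ * x + y) (q^-vanishes k i<k) (zeros (q ^ₛ k) i)

  n≤n*n : ∀ n → n ℕ.≤ n ℕ.* n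
  n≤n*n zero    = z≤n
  n≤n*n (suc n) = ℕ.m≤m+n (suc n) _

  term-vanishes : ∀ n → VanishesBelow n (term n)
  term-vanishes n i<n = /ₛ-vanishes (n ℕ.* n) _ (poch q (q ^ₛ 2) n)
    (*ₛ-vanishes (n ℕ.* n) _ (poch (-ₛ q) (q ^ₛ 2) n) (q^-vanishes (n ℕ.* n)))
    (ℕ.≤-trans i<n (n≤n*n n))

  sum-zero : ∀ m (h : ℕ → ℤ) → (∀ i → h i ≡ 0ℤ) → ∑[ i < m ] h (toℕ i) ≡ 0ℤ
  sum-zero zero    h h≈0 = refl
  sum-zero (suc m) h h≈0 = cong₂ _+_ (h≈0 0) (sum-zero m (h ∘ suc) (h≈0 ∘ suc))

  sum-stable : ∀ M m (h : ℕ → ℤ) → (∀ {i} → M ℕ.≤ i → h i ≡ 0ℤ) → M ℕ.≤ m →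
               ∑[ i < m ] h (toℕ i) ≡ ∑[ i < M ] h (toℕ i)
  sum-stable zero    m       h h≈0 _         = sum-zero m h (λ _ → h≈0 z≤n)
  sum-stable (suc M) (suc m) h h≈0 (s≤s M≤m) =
    cong (_+_ (h 0)) (sum-stable M m (h ∘ suc) (λ M≤i → h≈0 (s≤s M≤i)) M≤m)

v₀-isSum : IsSum term v₀
v₀-isSum N = suc N , λ m N<m →
  sum-stable (suc N) m (λ n → term n N) (λ {n} N<n → term-vanishes n N<n) N<m

{-# OPTIONS --safe #-}

-- The negative half of the bilateral series Σ_{n∈ℤ} q^{n²}(-q;q²)ₙ/(q;q²)ₙ is the
-- positive half with q replaced by -q, so the even part of V = 2 Σ v₀(n)qⁿ - 1 is that
-- bilateral series.  Inserting q^{2N} in its terms gives a family in N that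
-- satisfies a first-order recurrence in N, by telescoping, and tends to a theta
-- series as N → ∞; this yields Σ V(2n)qⁿ = φ(q)²/φ(-q²) with φ = Σ_{n∈ℤ} q^{n²}.  The
-- same recurrence with another sign gives φ(q)(q;q²)_∞ = φ(-q²)(-q;q²)_∞, and from
-- this φ(q)φ(-q) = φ(-q²)² and Jacobi's quartic identity.
--
-- Hence G = Σ V(4n)qⁿ = φ(q)²/φ(-q).  Let U extract the coefficients of the q^{4n},
-- t = (φ(q)/φ(-q))⁴ and z = t - 1.  Write φ = a(1 + u) with a = φ(q⁴) and u odd; then
-- u⁴ = 1 - 1/t(q⁴), U G = φ(1 + 4z), and z = 8u(1 + u²)/(1 - u)⁴ shows that U maps
-- φ z ℤ[t,1/t] into 8 φ z ℤ[t,1/t], while U φ = φ.  Since 16 divides z, the series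
-- U^α G is congruent to φ modulo 2^(3α + 3).
module Submission where

open import Defs
open import Data.Nat using (ℕ; _+_; _*_; _^_; _>_)
open import Data.Integer using (0ℤ; 1ℤ)
open import Data.Product using (_×_)
open import Relation.Nullary using (¬_)

open import Data.Nat using (zero; suc; _<_; _≤_; z≤n; s≤s)
import Data.Nat.Properties as ℕ
import Data.Fin as Fin
open import Data.Integer as ℤ using (ℤ; +_; -1ℤ)
import Data.Integer.Properties as ℤ
open import Data.Integer.Divisibility.Signed using (divides)
open import Data.Integer.Solver using (module +-*-Solver)
open import Data.Empty using (⊥; ⊥-elim)
open import Data.Maybe using (Maybe; just; nothing)
open import Data.Product using (_,_; proj₂; ∃-syntax)
open import Data.Sum using (_⊎_; inj₁; inj₂)
open import Algebra.Bundles using (CommutativeRing)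
open import Algebra.Structures using (IsCommutativeRing)
import Algebra.Solver.Ring as RingSolver
open import Algebra.Solver.Ring.AlmostCommutativeRing using (_-Raw-AlmostCommutative⟶_; fromCommutativeRing)
open import Function using (_∘_)
open import Level using (0ℓ)
open import Relation.Binary.Bundles using (Setoid)
open import Relation.Binary.Definitions using (tri<; tri≈; tri>)
open import Relation.Binary.PropositionalEquality
import Relation.Binary.Reasoning.Setoid as SetoidReasoning
open import Relation.Nullary using (Dec; yes; no)

-- The modulus `2^(3α + 2)` is `4 · 8^(α - 1) · 16 / 2`: the 4 of `U G = φ(1 + 4z)`, an 8 for each
-- of the `α - 1` further applications of `U`, the 16 dividing `z`, and one 2 lost because
-- `V = 2 v₀ - 1` and `φ = 2 Θ - 1`. A congruence alone would gain no factor 8 under `U`, so each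
-- step has to return the exact shape `φ z f`. Two facts provide this. First, `t` and `1/t` are
-- polynomials in `u` and `τ = t(q⁴)`, and `u⁴ = 1 - 1/τ`; hence every element of ℤ[t, 1/t] has
-- coordinates along `1, u, u², u³` with coefficients in ℤ[τ, 1/τ], and `U` reads off the first one.
-- Second, `z` is a multiple of `u`: the first coordinate then arises from `u · u³ = 1 - 1/τ`, which
-- becomes `1 - 1/t = z/t`, so the factor `z` reappears. The parameter `q^{2N}` is inserted because
-- for `N → ∞` the denominators tend to 1 and the terms to signed monomials. All these limits are
-- congruences modulo `q^K` between finite sums.

infix 4 _≈_ _≈[_]_
infixl 7 _·_
infixl 6 _⊕_ _⊝_
infix 8 ⊖_

-- The ring of formal power series

const : ℤ → PowerSeries
const c zero    = c
const c (suc _) = 0ℤ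

-- A record rather than a synonym of pointwise equality, so that unification recovers both series
-- from the type.
record _≈_ (f g : PowerSeries) : Set where
  constructor mk≈
  field coeff : ∀ n → f n ≡ g n
open _≈_

record _≈[_]_ (f : PowerSeries) (K : ℕ) (g : PowerSeries) : Set where
  constructor mk≈[]
  field coeff< : ∀ {i} → i < K → f i ≡ g i
open _≈[_]_

-- Opaque, because otherwise the conversion checker η-expands series and unfolds
-- convolutions when it compares the normal forms of the ring solver.
opaque
  _·_ _⊕_ : PowerSeries → PowerSeries → PowerSeries
  _·_ = _*ₛ_
  (f ⊕ g) n = f n ℤ.+ g n

  ⊖_ : PowerSeries → PowerSeries
  ⊖_ = -ₛ_

_⊝_ : PowerSeries → PowerSeries → PowerSeries
f ⊝ g = f ⊕ ⊖ g

≈-refl : ∀ {f} → f ≈ f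
≈-refl = mk≈ λ _ → refl

≈-sym : ∀ {f g} → f ≈ g → g ≈ f
≈-sym p = mk≈ λ n → sym (coeff p n)

≈-trans : ∀ {f g h} → f ≈ g → g ≈ h → f ≈ h
≈-trans p r = mk≈ λ n → trans (coeff p n) (coeff r n)

module _ where
  open ≡-Reasoning
  open +-*-Solver

  opaque
    unfolding _·_
    ·-zero : ∀ f g → (f · g) 0 ≡ f 0 ℤ.* g 0
    ·-zero f g = ℤ.+-identityʳ _

    ⊕-at : ∀ f g n → (f ⊕ g) n ≡ f n ℤ.+ g n
    ⊕-at f g n = refl

    ⊖-at : ∀ f n → (⊖ f) n ≡ ℤ.- f n
    ⊖-at f n = refl

    -- The convolution recurses on its left factor; peeling the right factor as well is what
    -- commutativity needs.
    ·-sucʳ : ∀ f g n → (f · g) (suc n) ≡ (f · (g ∘ suc)) n ℤ.+ f (suc n) ℤ.* g 0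
    ·-sucʳ f g zero    = solve 2 (λ x y → x :+ (y :+ con 0ℤ) := x :+ con 0ℤ :+ y) refl (f 0 ℤ.* g 1) (f 1 ℤ.* g 0)
    ·-sucʳ f g (suc n) = begin
      f 0 ℤ.* g (2 + n) ℤ.+ ((f ∘ suc) · g) (suc n)
        ≡⟨ cong (ℤ._+_ (f 0 ℤ.* g (2 + n))) (·-sucʳ (f ∘ suc) g n) ⟩
      f 0 ℤ.* g (2 + n) ℤ.+ (((f ∘ suc) · (g ∘ suc)) n ℤ.+ f (2 + n) ℤ.* g 0)
        ≡⟨ ℤ.+-assoc (f 0 ℤ.* g (2 + n)) (((f ∘ suc) · (g ∘ suc)) n) (f (2 + n) ℤ.* g 0) ⟨
      (f · (g ∘ suc)) (suc n) ℤ.+ f (2 + n) ℤ.* g 0 ∎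

    ·-comm-at : ∀ f g n → (f · g) n ≡ (g · f) n
    ·-comm-at f g zero    = cong (ℤ._+ 0ℤ) (ℤ.*-comm (f 0) (g 0))
    ·-comm-at f g (suc n) = begin
      f 0 ℤ.* g (suc n) ℤ.+ ((f ∘ suc) · g) n
        ≡⟨ cong₂ ℤ._+_ (ℤ.*-comm (f 0) _) (·-comm-at (f ∘ suc) g n) ⟩
      g (suc n) ℤ.* f 0 ℤ.+ (g · (f ∘ suc)) n
        ≡⟨ ℤ.+-comm (g (suc n) ℤ.* f 0) _ ⟩
      (g · (f ∘ suc)) n ℤ.+ g (suc n) ℤ.* f 0
        ≡⟨ ·-sucʳ g f n ⟨
      (g · f) (suc n) ∎

    ·-distribʳ-at : ∀ h f g n → ((f ⊕ g) · h) n ≡ (f · h) n ℤ.+ (g · h) n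
    ·-distribʳ-at h f g zero    =
      solve 3 (λ x y z → (x :+ y) :* z :+ con 0ℤ := x :* z :+ con 0ℤ :+ (y :* z :+ con 0ℤ)) refl (f 0) (g 0) (h 0)
    ·-distribʳ-at h f g (suc n) = begin
      (f 0 ℤ.+ g 0) ℤ.* h (suc n) ℤ.+ (((f ∘ suc) ⊕ (g ∘ suc)) · h) n
        ≡⟨ cong (ℤ._+_ ((f 0 ℤ.+ g 0) ℤ.* h (suc n))) (·-distribʳ-at h (f ∘ suc) (g ∘ suc) n) ⟩
      (f 0 ℤ.+ g 0) ℤ.* h (suc n) ℤ.+ (((f ∘ suc) · h) n ℤ.+ ((g ∘ suc) · h) n)
        ≡⟨ solve 5 (λ x y z a b → (x :+ y) :* z :+ (a :+ b) := x :* z :+ a :+ (y :* z :+ b)) refl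
             (f 0) (g 0) (h (suc n)) (((f ∘ suc) · h) n) (((g ∘ suc) · h) n) ⟩
      (f · h) (suc n) ℤ.+ (g · h) (suc n) ∎

    ·-scale-at : ∀ c f g n → ((λ m → c ℤ.* f m) · g) n ≡ c ℤ.* (f · g) n
    ·-scale-at c f g zero    =
      solve 3 (λ c x y → c :* x :* y :+ con 0ℤ := c :* (x :* y :+ con 0ℤ)) refl c (f 0) (g 0)
    ·-scale-at c f g (suc n) = begin
      c ℤ.* f 0 ℤ.* g (suc n) ℤ.+ ((λ m → c ℤ.* f (suc m)) · g) n
        ≡⟨ cong (ℤ._+_ (c ℤ.* f 0 ℤ.* g (suc n))) (·-scale-at c (f ∘ suc) g n) ⟩
      c ℤ.* f 0 ℤ.* g (suc n) ℤ.+ c ℤ.* ((f ∘ suc) · g) n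
        ≡⟨ solve 4 (λ c x y z → c :* x :* y :+ c :* z := c :* (x :* y :+ z)) refl
             c (f 0) (g (suc n)) (((f ∘ suc) · g) n) ⟩
      c ℤ.* (f · g) (suc n) ∎

    ·-assoc-at : ∀ f g h n → ((f · g) · h) n ≡ (f · (g · h)) n
    ·-assoc-at f g h zero    =
      solve 3 (λ x y z → (x :* y :+ con 0ℤ) :* z :+ con 0ℤ := x :* (y :* z :+ con 0ℤ) :+ con 0ℤ) refl (f 0) (g 0) (h 0)
    ·-assoc-at f g h (suc n) = begin
      -- The tail of `f · g` unfolds to `f 0` times the tail of `g`, plus `(f ∘ suc) · g`.
      fg₀h ℤ.+ (((λ m → f 0 ℤ.* g (suc m)) ⊕ ((f ∘ suc) · g)) · h) n
        ≡⟨ cong (ℤ._+_ fg₀h) (·-distribʳ-at h (λ m → f 0 ℤ.* g (suc m)) ((f ∘ suc) · g) n) ⟩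
      fg₀h ℤ.+ (((λ m → f 0 ℤ.* g (suc m)) · h) n ℤ.+ (((f ∘ suc) · g) · h) n)
        ≡⟨ cong (ℤ._+_ fg₀h) (cong₂ ℤ._+_ (·-scale-at (f 0) (g ∘ suc) h n) (·-assoc-at (f ∘ suc) g h n)) ⟩
      fg₀h ℤ.+ (f 0 ℤ.* ((g ∘ suc) · h) n ℤ.+ ((f ∘ suc) · (g · h)) n)
        ≡⟨ solve 5 (λ x y z a b → (x :* y :+ con 0ℤ) :* z :+ (x :* a :+ b) := x :* (y :* z :+ a) :+ b) refl
             (f 0) (g 0) (h (suc n)) (((g ∘ suc) · h) n) (((f ∘ suc) · (g · h)) n) ⟩
      (f · (g · h)) (suc n) ∎
      where
      fg₀h : ℤ
      fg₀h = (f 0 ℤ.* g 0 ℤ.+ 0ℤ) ℤ.* h (suc n)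

    -- Finite dependence of the coefficients of a product: both congruence for `_≈_` and truncation
    -- modulo `q^K` come from it.
    ·-local : ∀ n {f f′ g g′ : PowerSeries} → (∀ {i} → i ≤ n → f i ≡ f′ i) → (∀ {i} → i ≤ n → g i ≡ g′ i) →
              (f · g) n ≡ (f′ · g′) n
    ·-local zero    p r = cong (ℤ._+ 0ℤ) (cong₂ ℤ._*_ (p z≤n) (r z≤n))
    ·-local (suc n) p r =
      cong₂ ℤ._+_ (cong₂ ℤ._*_ (p z≤n) (r ℕ.≤-refl)) (·-local n (p ∘ s≤s) (r ∘ ℕ.m≤n⇒m≤1+n))

    zeros-· : ∀ f n → ((λ _ → 0ℤ) · f) n ≡ 0ℤ
    zeros-· f zero    = refl
    zeros-· f (suc n) = trans (ℤ.+-identityˡ _) (zeros-· f n)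

    const-·-at : ∀ c f n → (const c · f) n ≡ c ℤ.* f n
    const-·-at c f zero    = ℤ.+-identityʳ _
    const-·-at c f (suc n) = trans (cong (ℤ._+_ (c ℤ.* f (suc n))) (zeros-· f n)) (ℤ.+-identityʳ _)

    ⊕-cong : ∀ {f f′ g g′} → f ≈ f′ → g ≈ g′ → f ⊕ g ≈ f′ ⊕ g′
    ⊕-cong p r = mk≈ λ n → cong₂ ℤ._+_ (coeff p n) (coeff r n)

    ·-cong : ∀ {f f′ g g′} → f ≈ f′ → g ≈ g′ → f · g ≈ f′ · g′
    ·-cong p r = mk≈ λ n → ·-local n (λ {i} _ → coeff p i) (λ {i} _ → coeff r i)

    ⊖-cong : ∀ {f f′} → f ≈ f′ → ⊖ f ≈ ⊖ f′
    ⊖-cong p = mk≈ λ n → cong ℤ.-_ (coeff p n)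

    ·-comm : ∀ f g → f · g ≈ g · f
    ·-comm f g = mk≈ (·-comm-at f g)

    isCommutativeRing : IsCommutativeRing _≈_ _⊕_ _·_ ⊖_ (const 0ℤ) (const 1ℤ)
    isCommutativeRing = record
      { isRing = record
        { +-isAbelianGroup = record
          { isGroup = record
            { isMonoid = record
              { isSemigroup = record
                { isMagma = record
                  { isEquivalence = record { refl = ≈-refl ; sym = ≈-sym ; trans = ≈-trans }
                  ; ∙-cong = ⊕-cong }
                ; assoc = λ f g h → mk≈ λ n → ℤ.+-assoc (f n) (g n) (h n) }
              ; identity = (λ f → mk≈ λ { zero → ℤ.+-identityˡ _ ; (suc _) → ℤ.+-identityˡ _ })
                         , (λ f → mk≈ λ { zero → ℤ.+-identityʳ _ ; (suc _) → ℤ.+-identityʳ _ }) }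
            ; inverse = (λ f → mk≈ λ { zero → ℤ.+-inverseˡ (f 0) ; (suc n) → ℤ.+-inverseˡ (f (suc n)) })
                      , (λ f → mk≈ λ { zero → ℤ.+-inverseʳ (f 0) ; (suc n) → ℤ.+-inverseʳ (f (suc n)) })
            ; ⁻¹-cong = ⊖-cong }
          ; comm = λ f g → mk≈ λ n → ℤ.+-comm (f n) (g n) }
        ; *-cong = ·-cong
        ; *-assoc = λ f g h → mk≈ (·-assoc-at f g h)
        ; *-identity = identityˡ , λ f → ≈-trans (·-comm f (const 1ℤ)) (identityˡ f)
        ; distrib = (λ h f g → ≈-trans (·-comm h (f ⊕ g))
                      (≈-trans (distribʳ h f g) (⊕-cong (·-comm f h) (·-comm g h))))
                  , distribʳ }
      ; *-comm = ·-comm }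
      where
      identityˡ : ∀ f → const 1ℤ · f ≈ f
      identityˡ f = mk≈ λ n → trans (const-·-at 1ℤ f n) (ℤ.*-identityˡ _)
      distribʳ : ∀ h f g → (f ⊕ g) · h ≈ f · h ⊕ g · h
      distribʳ h f g = mk≈ (·-distribʳ-at h f g)

    const-+ : ∀ c d → const (c ℤ.+ d) ≈ const c ⊕ const d
    const-+ c d = mk≈ λ { zero → refl ; (suc _) → refl }

    const-* : ∀ c d → const (c ℤ.* d) ≈ const c · const d
    const-* c d = mk≈ λ { zero → sym (ℤ.+-identityʳ _)
                        ; (suc n) → sym (trans (const-·-at c (const d) (suc n)) (ℤ.*-zeroʳ c)) }

    const-neg : ∀ c → const (ℤ.- c) ≈ ⊖ const c
    const-neg c = mk≈ λ { zero → refl ; (suc _) → refl }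

powerSeriesRing : CommutativeRing 0ℓ 0ℓ
powerSeriesRing = record { isCommutativeRing = isCommutativeRing }

const-homomorphism : ℤ.+-*-rawRing -Raw-AlmostCommutative⟶ fromCommutativeRing powerSeriesRing
const-homomorphism = record
  { ⟦_⟧ = const ; +-homo = const-+ ; *-homo = const-* ; -‿homo = const-neg
  ; 0-homo = ≈-refl ; 1-homo = ≈-refl }

const≟ : ∀ c d → Maybe (const c ≈ const d)
const≟ c d with c ℤ.≟ d
... | yes refl = just ≈-refl
... | no _     = nothing

open RingSolver ℤ.+-*-rawRing (fromCommutativeRing powerSeriesRing) const-homomorphism const≟ public
module ≈-Reasoning = SetoidReasoning (CommutativeRing.setoid powerSeriesRing)

·-congˡ : ∀ f {g g′} → g ≈ g′ → f · g ≈ f · g′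
·-congˡ f = ·-cong (≈-refl {f})

·-congʳ : ∀ g {f f′} → f ≈ f′ → f · g ≈ f′ · g
·-congʳ g p = ·-cong p (≈-refl {g})

⊝-cong : ∀ {f f′ g g′} → f ≈ f′ → g ≈ g′ → f ⊝ g ≈ f′ ⊝ g′
⊝-cong p r = ⊕-cong p (⊖-cong r)

-- Congruence modulo q^K

modSetoid : ℕ → Setoid 0ℓ 0ℓ
modSetoid K = record
  { _≈_ = _≈[ K ]_
  ; isEquivalence = record
    { refl  = mk≈[] λ _ → refl
    ; sym   = λ p → mk≈[] λ i<K → sym (coeff< p i<K)
    ; trans = λ p r → mk≈[] λ i<K → trans (coeff< p i<K) (coeff< r i<K) } }

module Mod (K : ℕ) where
  open Setoid (modSetoid K) public using () renaming (refl to []-refl; sym to []-sym; trans to []-trans)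
  open SetoidReasoning (modSetoid K) public

  trunc : ∀ {f g} → f ≈ g → f ≈[ K ] g
  trunc p = mk≈[] λ {i} _ → coeff p i

  opaque
    unfolding _·_

    []-⊕ : ∀ {f f′ g g′} → f ≈[ K ] f′ → g ≈[ K ] g′ → f ⊕ g ≈[ K ] f′ ⊕ g′
    []-⊕ p r = mk≈[] λ i<K → cong₂ ℤ._+_ (coeff< p i<K) (coeff< r i<K)

    []-⊖ : ∀ {f f′} → f ≈[ K ] f′ → ⊖ f ≈[ K ] ⊖ f′
    []-⊖ p = mk≈[] λ i<K → cong ℤ.-_ (coeff< p i<K)

    []-· : ∀ {f f′ g g′} → f ≈[ K ] f′ → g ≈[ K ] g′ → f · g ≈[ K ] f′ · g′
    []-· p r = mk≈[] λ {i} i<K → ·-local i (λ j≤i → coeff< p (ℕ.≤-<-trans j≤i i<K))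
                                           (λ j≤i → coeff< r (ℕ.≤-<-trans j≤i i<K))

  []-·ˡ : ∀ f {g g′} → g ≈[ K ] g′ → f · g ≈[ K ] f · g′
  []-·ˡ f = []-· ([]-refl {f})

  []-·ʳ : ∀ g {f f′} → f ≈[ K ] f′ → f · g ≈[ K ] f′ · g
  []-·ʳ g p = []-· p ([]-refl {g})

≈-from-mod : ∀ {f g} → (∀ K → f ≈[ K ] g) → f ≈ g
≈-from-mod p = mk≈ λ n → coeff< (p (suc n)) ℕ.≤-refl

-- Series with constant term 1 and their inverses

Monic : PowerSeries → Set
Monic f = f 0 ≡ 1ℤ

inv : PowerSeries → PowerSeries
inv f = const 1ℤ /ₛ f

opaque
  unfolding _·_

  inv-inverse : ∀ f → Monic f → inv f · f ≈ const 1ℤ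
  inv-inverse f f₀ = mk≈ (/ₛ-*ₛ (const 1ℤ) f f₀)

  Monic-· : ∀ f g → Monic f → Monic g → Monic (f · g)
  Monic-· f g f₀ g₀ = trans (·-zero f g) (cong₂ ℤ._*_ f₀ g₀)

  Monic-1⊕ : ∀ f → f 0 ≡ 0ℤ → Monic (const 1ℤ ⊕ f)
  Monic-1⊕ f f₀ = cong (ℤ._+_ 1ℤ) f₀

  Monic-1⊝ : ∀ f → f 0 ≡ 0ℤ → Monic (const 1ℤ ⊝ f)
  Monic-1⊝ f f₀ = cong (λ x → 1ℤ ℤ.+ ℤ.- x) f₀

  ·-zeroʳ : ∀ f g → g 0 ≡ 0ℤ → (f · g) 0 ≡ 0ℤ
  ·-zeroʳ f g g₀ = trans (·-zero f g) (trans (cong (f 0 ℤ.*_) g₀) (ℤ.*-zeroʳ (f 0)))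

[]-cancel : ∀ K h {f g} → Monic h → h · f ≈[ K ] h · g → f ≈[ K ] g
[]-cancel K h {f} {g} h₀ p = begin
  f              ≈⟨ trunc (unit f) ⟨
  inv h · (h · f) ≈⟨ []-·ˡ (inv h) p ⟩
  inv h · (h · g) ≈⟨ trunc (unit g) ⟩
  g              ∎
  where
  open Mod K
  unit : ∀ f → inv h · (h · f) ≈ f
  unit f = ≈-trans (solve 3 (λ i h f → i :* (h :* f) := i :* h :* f) ≈-refl (inv h) h f)
           (≈-trans (·-congʳ f (inv-inverse h h₀)) (solve 1 (λ f → con 1ℤ :* f := f) ≈-refl f))

cancel : ∀ h {f g} → Monic h → h · f ≈ h · g → f ≈ g
cancel h h₀ p = ≈-from-mod λ K → []-cancel K h h₀ (Mod.trunc K p)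

-- Powers of q

-- The powers `q ^ₛ n` rebuilt from the opaque product and the solver's unit `const 1ℤ`; `q^≈X`
-- identifies the two.
X : ℕ → PowerSeries
X zero    = const 1ℤ
X (suc n) = q · X n

q·-zero : ∀ f → (q · f) 0 ≡ 0ℤ
q·-zero f = ·-zero q f

opaque
  unfolding _·_

  q·-suc : ∀ f n → (q · f) (suc n) ≡ f n
  q·-suc f n = trans (ℤ.+-identityˡ _) (trans (·-local n {g = f} (λ {i} _ → q∘suc i) (λ _ → refl))
                 (trans (const-·-at 1ℤ f n) (ℤ.*-identityˡ _)))
    where
    q∘suc : ∀ i → q (suc i) ≡ const 1ℤ i
    q∘suc zero    = refl
    q∘suc (suc _) = refl

q-cancel : ∀ {f g} → q · f ≈ q · g → f ≈ g
q-cancel {f} {g} p = mk≈ λ n → trans (sym (q·-suc f n)) (trans (coeff p (suc n)) (q·-suc g n))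

-- Stands in for negative powers of `q`: an identity is multiplied by a power of `q` and divided by
-- it afterwards.
X-cancel : ∀ k {f g} → X k · f ≈ X k · g → f ≈ g
X-cancel zero    {f} {g} p = ≈-trans (≈-sym (one f)) (≈-trans p (one g))
  where
  one : ∀ f → const 1ℤ · f ≈ f
  one = solve 1 (λ f → con 1ℤ :* f := f) ≈-refl
X-cancel (suc k) {f} {g} p = X-cancel k (q-cancel (≈-trans (≈-sym (assoc f)) (≈-trans p (assoc g))))
  where
  assoc : ∀ f → q · X k · f ≈ q · (X k · f)
  assoc = solve 3 (λ q x f → q :* x :* f := q :* (x :* f)) ≈-refl q (X k)

X-+ : ∀ m n → X (m + n) ≈ X m · X n
X-+ zero    n = solve 1 (λ f → f := con 1ℤ :* f) ≈-refl (X n)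
X-+ (suc m) n = ≈-trans (·-congˡ q (X-+ m n)) (solve 3 (λ q x y → q :* (x :* y) := q :* x :* y) ≈-refl q (X m) (X n))

X-diagonal : ∀ n → X n n ≡ 1ℤ
X-diagonal zero    = refl
X-diagonal (suc n) = trans (q·-suc (X n) n) (X-diagonal n)

X-off-diagonal : ∀ m n → m ≢ n → X m n ≡ 0ℤ
X-off-diagonal zero    zero    m≢n with () ← m≢n refl
X-off-diagonal zero    (suc n) m≢n = refl
X-off-diagonal (suc m) zero    m≢n = q·-zero (X m)
X-off-diagonal (suc m) (suc n) m≢n = trans (q·-suc (X m) n) (X-off-diagonal m n (m≢n ∘ cong suc))

X·-vanishes : ∀ k f {i} → i < k → (X k · f) i ≡ 0ℤ
X·-vanishes k f {i} i<k = trans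
  (·-local i (λ {j} j≤i → X-off-diagonal k j (ℕ.>⇒≢ (ℕ.≤-<-trans j≤i i<k))) (λ _ → refl)) (zeros-· f i)

X·≈[]0 : ∀ K k f → K ≤ k → X k · f ≈[ K ] const 0ℤ
X·≈[]0 K k f K≤k = mk≈[] λ {i} i<K → trans (X·-vanishes k f (ℕ.<-≤-trans i<K K≤k)) (zero-at i)
  where
  zero-at : ∀ i → 0ℤ ≡ const 0ℤ i
  zero-at zero    = refl
  zero-at (suc _) = refl

-- Dissection into even and odd parts

-- D f = f(q²) and N f = f(-q)
D : PowerSeries → PowerSeries
D f zero          = f 0
D f (suc zero)    = 0ℤ
D f (suc (suc n)) = D (f ∘ suc) n

N : PowerSeries → PowerSeries
N f zero    = f 0
N f (suc n) = ℤ.- N (f ∘ suc) n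

ev od : PowerSeries → PowerSeries
ev f n = f (n + n)
od f n = f (suc (n + n))

ev-cong : ∀ {f g} → f ≈ g → ev f ≈ ev g
ev-cong p = mk≈ λ n → coeff p (n + n)

od-cong : ∀ {f g} → f ≈ g → od f ≈ od g
od-cong p = mk≈ λ n → coeff p (suc (n + n))

even-or-odd : ∀ n → ∃[ k ] (n ≡ k + k ⊎ n ≡ suc (k + k))
even-or-odd zero = 0 , inj₁ refl
even-or-odd (suc n) with even-or-odd n
... | k , inj₁ p = k , inj₂ (cong suc p)
... | k , inj₂ p = suc k , inj₁ (trans (cong suc p) (cong suc (sym (ℕ.+-suc k k))))

even-odd-ext : ∀ {f g} → ev f ≈ ev g → od f ≈ od g → f ≈ g
even-odd-ext {f} {g} p r = mk≈ at
  where
  at : ∀ n → f n ≡ g n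
  at n with even-or-odd n
  ... | k , inj₁ refl = coeff p k
  ... | k , inj₂ refl = coeff r k

ev-D : ∀ f → ev (D f) ≈ f
ev-D f = mk≈ (at f)
  where
  at : ∀ f n → D f (n + n) ≡ f n
  at f zero    = refl
  at f (suc n) = trans (cong (D f ∘ suc) (ℕ.+-suc n n)) (at (f ∘ suc) n)

od-D : ∀ f n → od (D f) n ≡ 0ℤ
od-D f zero    = refl
od-D f (suc n) = trans (cong (D f ∘ suc ∘ suc) (ℕ.+-suc n n)) (od-D (f ∘ suc) n)

opaque
  unfolding _·_

  ev-⊕ : ∀ f g → ev (f ⊕ g) ≈ ev f ⊕ ev g
  ev-⊕ f g = ≈-refl

  ev-⊖ : ∀ f → ev (⊖ f) ≈ ⊖ ev f
  ev-⊖ f = ≈-refl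

  ev-Dq : ∀ f g → ev (D f ⊕ q · D g) ≈ f
  ev-Dq f g = mk≈ λ n → trans (cong₂ ℤ._+_ (coeff (ev-D f) n) (odd n)) (ℤ.+-identityʳ (f n))
    where
    odd : ∀ n → (q · D g) (n + n) ≡ 0ℤ
    odd zero    = q·-zero (D g)
    odd (suc n) = trans (q·-suc (D g) (n + suc n)) (trans (cong (D g) (ℕ.+-suc n n)) (od-D g n))

  od-Dq : ∀ f g → od (D f ⊕ q · D g) ≈ g
  od-Dq f g = mk≈ λ n → trans (cong₂ ℤ._+_ (od-D f n) (trans (q·-suc (D g) (n + n)) (coeff (ev-D g) n))) (ℤ.+-identityˡ (g n))

dissect : ∀ f → f ≈ D (ev f) ⊕ q · D (od f)
dissect f = even-odd-ext (≈-sym (ev-Dq (ev f) (od f))) (≈-sym (od-Dq (ev f) (od f)))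

ev-const : ∀ c → ev (const c) ≈ const c
ev-const c = mk≈ λ { zero → refl ; (suc _) → refl }

D-cong : ∀ {f g} → f ≈ g → D f ≈ D g
D-cong p = mk≈ (at p)
  where
  at : ∀ {f g} → f ≈ g → ∀ n → D f n ≡ D g n
  at p zero          = coeff p 0
  at p (suc zero)    = refl
  at p (suc (suc n)) = at (mk≈ (coeff p ∘ suc)) n

D-injective : ∀ {f g} → D f ≈ D g → f ≈ g
D-injective {f} {g} p = ≈-trans (≈-sym (ev-D f)) (≈-trans (ev-cong p) (ev-D g))

-- `D` doubles exponents, so half of the precision is lost; this is why `W-product` works modulo
-- `q^(K + K)`.
D-injective[] : ∀ K {f g} → D f ≈[ K + K ] D g → f ≈[ K ] g
D-injective[] K {f} {g} p = mk≈[] λ {i} i<K →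
  trans (sym (coeff (ev-D f) i)) (trans (coeff< p (ℕ.+-mono-< i<K i<K)) (coeff (ev-D g) i))

opaque
  unfolding _·_

  D-⊕ : ∀ f g → D (f ⊕ g) ≈ D f ⊕ D g
  D-⊕ f g = mk≈ (at f g)
    where
    at : ∀ f g n → D (f ⊕ g) n ≡ (D f ⊕ D g) n
    at f g zero          = refl
    at f g (suc zero)    = refl
    at f g (suc (suc n)) = at (f ∘ suc) (g ∘ suc) n

  D-⊖ : ∀ f → D (⊖ f) ≈ ⊖ D f
  D-⊖ f = mk≈ (at f)
    where
    at : ∀ f n → D (⊖ f) n ≡ ℤ.- D f n
    at f zero          = refl
    at f (suc zero)    = refl
    at f (suc (suc n)) = at (f ∘ suc) n

  D-scale : ∀ c f n → D (λ m → c ℤ.* f m) n ≡ c ℤ.* D f n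
  D-scale c f zero          = refl
  D-scale c f (suc zero)    = sym (ℤ.*-zeroʳ c)
  D-scale c f (suc (suc n)) = D-scale c (f ∘ suc) n

  D-· : ∀ f g → D (f · g) ≈ D f · D g
  D-· f g = mk≈ (at f g)
    where
    open ≡-Reasoning
    at : ∀ f g n → D (f · g) n ≡ (D f · D g) n
    at f g zero          = refl
    at f g (suc zero)    = sym (cong (ℤ._+ 0ℤ) (ℤ.*-zeroʳ (f 0)))
    at f g (suc (suc n)) = begin
      D ((λ m → f 0 ℤ.* g (suc m)) ⊕ ((f ∘ suc) · g)) n
        ≡⟨ coeff (D-⊕ (λ m → f 0 ℤ.* g (suc m)) ((f ∘ suc) · g)) n ⟩
      D (λ m → f 0 ℤ.* g (suc m)) n ℤ.+ D ((f ∘ suc) · g) n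
        ≡⟨ cong₂ ℤ._+_ (D-scale (f 0) (g ∘ suc) n) (at (f ∘ suc) g n) ⟩
      f 0 ℤ.* D (g ∘ suc) n ℤ.+ (D (f ∘ suc) · D g) n
        ≡⟨ cong (ℤ._+_ (f 0 ℤ.* D (g ∘ suc) n)) (ℤ.+-identityˡ ((D (f ∘ suc) · D g) n)) ⟨
      f 0 ℤ.* D (g ∘ suc) n ℤ.+ (0ℤ ℤ.+ (D (f ∘ suc) · D g) n) ∎

  D-const : ∀ c → D (const c) ≈ const c
  D-const c = mk≈ λ { zero → refl ; (suc zero) → refl ; (suc (suc n)) → zeros n }
    where
    zeros : ∀ n → D (λ _ → 0ℤ) n ≡ 0ℤ
    zeros zero          = refl
    zeros (suc zero)    = refl
    zeros (suc (suc n)) = zeros n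

  N-⊕ : ∀ f g → N (f ⊕ g) ≈ N f ⊕ N g
  N-⊕ f g = mk≈ (at f g)
    where
    at : ∀ f g n → N (f ⊕ g) n ≡ (N f ⊕ N g) n
    at f g zero    = refl
    at f g (suc n) = trans (cong ℤ.-_ (at (f ∘ suc) (g ∘ suc) n)) (ℤ.neg-distrib-+ (N (f ∘ suc) n) (N (g ∘ suc) n))

  N-⊖ : ∀ f → N (⊖ f) ≈ ⊖ N f
  N-⊖ f = mk≈ (at f)
    where
    at : ∀ f n → N (⊖ f) n ≡ ℤ.- N f n
    at f zero    = refl
    at f (suc n) = cong ℤ.-_ (at (f ∘ suc) n)

  N-scale : ∀ c f n → N (λ m → c ℤ.* f m) n ≡ c ℤ.* N f n
  N-scale c f zero    = refl
  N-scale c f (suc n) = trans (cong ℤ.-_ (N-scale c (f ∘ suc) n)) (ℤ.neg-distribʳ-* c (N (f ∘ suc) n))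

  N-· : ∀ f g → N (f · g) ≈ N f · N g
  N-· f g = mk≈ (at f g)
    where
    open ≡-Reasoning
    at : ∀ f g n → N (f · g) n ≡ (N f · N g) n
    at f g zero    = refl
    at f g (suc n) = begin
      ℤ.- N ((λ m → f 0 ℤ.* g (suc m)) ⊕ ((f ∘ suc) · g)) n
        ≡⟨ cong ℤ.-_ (coeff (N-⊕ (λ m → f 0 ℤ.* g (suc m)) ((f ∘ suc) · g)) n) ⟩
      ℤ.- (N (λ m → f 0 ℤ.* g (suc m)) n ℤ.+ N ((f ∘ suc) · g) n)
        ≡⟨ ℤ.neg-distrib-+ (N (λ m → f 0 ℤ.* g (suc m)) n) (N ((f ∘ suc) · g) n) ⟩
      ℤ.- N (λ m → f 0 ℤ.* g (suc m)) n ℤ.+ ℤ.- N ((f ∘ suc) · g) n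
        ≡⟨ cong₂ (λ x y → ℤ.- x ℤ.+ ℤ.- y) (N-scale (f 0) (g ∘ suc) n) (at (f ∘ suc) g n) ⟩
      ℤ.- (f 0 ℤ.* N (g ∘ suc) n) ℤ.+ ℤ.- (N (f ∘ suc) · N g) n
        ≡⟨ cong₂ ℤ._+_ (ℤ.neg-distribʳ-* (f 0) (N (g ∘ suc) n)) (neg-·-at (N (f ∘ suc)) (N g) n) ⟩
      f 0 ℤ.* (ℤ.- N (g ∘ suc) n) ℤ.+ ((⊖ N (f ∘ suc)) · N g) n ∎
      where
      neg-·-at : ∀ f g n → ℤ.- (f · g) n ≡ ((⊖ f) · g) n
      neg-·-at f g = coeff (solve 2 (λ f g → :- (f :* g) := (:- f) :* g) ≈-refl f g)

N-const : ∀ c → N (const c) ≈ const c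
N-const c = mk≈ λ { zero → refl ; (suc n) → cong ℤ.-_ (zeros n) }
  where
  zeros : ∀ n → N (λ _ → 0ℤ) n ≡ 0ℤ
  zeros zero    = refl
  zeros (suc n) = cong ℤ.-_ (zeros n)

N-local : ∀ {f g} n → f n ≡ g n → N f n ≡ N g n
N-local zero    p = p
N-local (suc n) p = cong ℤ.-_ (N-local n p)

N-cong : ∀ {f g} → f ≈ g → N f ≈ N g
N-cong p = mk≈ λ n → N-local n (coeff p n)

N-cong[] : ∀ {K f g} → f ≈[ K ] g → N f ≈[ K ] N g
N-cong[] p = mk≈[] λ {i} i<K → N-local i (coeff< p i<K)

N-involutive : ∀ f → N (N f) ≈ f
N-involutive f = mk≈ (at f)
  where
  neg : ∀ f n → N (λ m → ℤ.- f m) n ≡ ℤ.- N f n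
  neg f zero    = refl
  neg f (suc n) = cong ℤ.-_ (neg (f ∘ suc) n)
  at : ∀ f n → N (N f) n ≡ f n
  at f zero    = refl
  at f (suc n) = trans (cong ℤ.-_ (trans (neg (N (f ∘ suc)) n) (cong ℤ.-_ (at (f ∘ suc) n)))) (ℤ.neg-involutive (f (suc n)))

N-even : ∀ f n → N f (n + n) ≡ f (n + n)
N-even f zero    = refl
N-even f (suc n) = trans (cong (λ m → N f (suc m)) (ℕ.+-suc n n))
  (trans (ℤ.neg-involutive _) (trans (N-even (f ∘ suc ∘ suc) n) (cong (f ∘ suc) (sym (ℕ.+-suc n n)))))

opaque
  unfolding _·_

  f⊕Nf : ∀ f → f ⊕ N f ≈ const (+ 2) · D (ev f)
  f⊕Nf f = even-odd-ext
    (mk≈ λ n → trans (trans (cong (ℤ._+_ (f (n + n))) (N-even f n)) (double (f (n + n))))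
               (sym (trans (const-·-at (+ 2) (D (ev f)) (n + n)) (cong (+ 2 ℤ.*_) (coeff (ev-D (ev f)) n)))))
    (mk≈ λ n → trans (trans (cong (λ x → f (suc (n + n)) ℤ.+ ℤ.- x) (N-even (f ∘ suc) n)) (ℤ.+-inverseʳ (f (suc (n + n)))))
               (sym (trans (const-·-at (+ 2) (D (ev f)) (suc (n + n))) (cong (+ 2 ℤ.*_) (od-D (ev f) n)))))
    where
    double : ∀ x → x ℤ.+ x ≡ + 2 ℤ.* x
    double = +-*-Solver.solve 1 (λ x → x +-*-Solver.:+ x +-*-Solver.:= +-*-Solver.con (+ 2) +-*-Solver.:* x) refl

D-q : D q ≈ q · q
D-q = mk≈ λ { zero → sym (q·-zero q) ; (suc zero) → sym (q·-suc q 0) ; (suc (suc n)) → trans (tail n) (sym (q·-suc q (suc n))) }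
  where
  tail : ∀ n → D (q ∘ suc) n ≡ q (suc n)
  tail zero          = refl
  tail (suc zero)    = refl
  tail (suc (suc n)) = coeff (D-const 0ℤ) (2 + n)

N-q : N q ≈ ⊖ q
N-q = mk≈ λ { zero → sym (⊖-at q 0) ; (suc n) → trans (cong ℤ.-_ (tail n)) (sym (⊖-at q (suc n))) }
  where
  tail : ∀ n → N (q ∘ suc) n ≡ q (suc n)
  tail zero    = refl
  tail (suc n) = coeff (N-const 0ℤ) (suc n)

N-D : ∀ f → N (D f) ≈ D f
N-D f = even-odd-ext (mk≈ λ n → N-even (D f) n)
  (mk≈ λ n → trans (cong ℤ.-_ (N-even (D f ∘ suc) n)) (trans (cong ℤ.-_ (od-D f n)) (sym (od-D f n))))

-- Partial sums and infinite sums

psum : (ℕ → PowerSeries) → ℕ → PowerSeries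
psum F zero    = const 0ℤ
psum F (suc M) = psum F M ⊕ F M

psum-cong : ∀ {F G} → (∀ n → F n ≈ G n) → ∀ M → psum F M ≈ psum G M
psum-cong p zero    = ≈-refl
psum-cong p (suc M) = ⊕-cong (psum-cong p M) (p M)

psum-cong[] : ∀ {K F G} → (∀ n → F n ≈[ K ] G n) → ∀ M → psum F M ≈[ K ] psum G M
psum-cong[] {K} p zero    = Mod.[]-refl K
psum-cong[] {K} p (suc M) = Mod.[]-⊕ K (psum-cong[] p M) (p M)

psum-D : ∀ F M → psum (D ∘ F) M ≈ D (psum F M)
psum-D F zero    = ≈-sym (D-const 0ℤ)
psum-D F (suc M) = ≈-trans (⊕-cong (psum-D F M) ≈-refl) (≈-sym (D-⊕ (psum F M) (F M)))

psum-N : ∀ F M → psum (N ∘ F) M ≈ N (psum F M)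
psum-N F zero    = ≈-sym (N-const 0ℤ)
psum-N F (suc M) = ≈-trans (⊕-cong (psum-N F M) ≈-refl) (≈-sym (N-⊕ (psum F M) (F M)))

psum-front : ∀ F M → psum F (suc M) ≈ F 0 ⊕ psum (F ∘ suc) M
psum-front F zero    = solve 1 (λ f → con 0ℤ :+ f := f :+ con 0ℤ) ≈-refl (F 0)
psum-front F (suc M) = ≈-trans (⊕-cong (psum-front F M) ≈-refl)
  (solve 3 (λ x y z → x :+ y :+ z := x :+ (y :+ z)) ≈-refl (F 0) (psum (F ∘ suc) M) (F (suc M)))

-- The infinite sum, provided that `qⁿ` divides `F n`: terms beyond the `i`-th then do not reach the
-- coefficient of `qⁱ`.
total : (ℕ → PowerSeries) → PowerSeries
total F i = psum F (suc i) i

total-cong : ∀ {F G} → (∀ n → F n ≈ G n) → total F ≈ total G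
total-cong p = mk≈ λ i → coeff (psum-cong p (suc i)) i

psum≈[]total : ∀ K F → (∀ n → ∃[ g ] F n ≈ X n · g) → psum F (suc K) ≈[ K ] total F
psum≈[]total K F order = mk≈[] λ {i} i<K → stable i (ℕ.m≤n⇒m≤1+n i<K)
  where
  stable : ∀ i {M} → suc i ≤ M → psum F M i ≡ psum F (suc i) i
  stable i 1+i≤M with ℕ.m≤n⇒m<n∨m≡n 1+i≤M
  stable i _ | inj₂ refl = refl
  stable i _ | inj₁ (s≤s {n = M} i<M) = trans (⊕-at (psum F M) (F M) i)
    (trans (cong (ℤ._+_ (psum F M i)) (trans (coeff (proj₂ (order M)) i) (X·-vanishes M _ i<M)))
      (trans (ℤ.+-identityʳ _) (stable i i<M)))

D-cong[] : ∀ {K f g} → f ≈[ K ] g → D f ≈[ K ] D g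
D-cong[] p = mk≈[] λ {n} n<K → at n (λ i≤n → coeff< p (ℕ.≤-<-trans i≤n n<K))
  where
  at : ∀ n {f g : PowerSeries} → (∀ {i} → i ≤ n → f i ≡ g i) → D f n ≡ D g n
  at zero          p = p z≤n
  at (suc zero)    p = refl
  at (suc (suc n)) p = at n (λ i≤n → p (s≤s (ℕ.m≤n⇒m≤1+n i≤n)))

weaken : ∀ {K L f g} → K ≤ L → f ≈[ L ] g → f ≈[ K ] g
weaken K≤L p = mk≈[] λ i<K → coeff< p (ℕ.<-≤-trans i<K K≤L)

-- Telescoping

X² : ℕ → PowerSeries
X² n = X (n + n)

X²-suc : ∀ n → X² (suc n) ≈ X² n · (q · q)
X²-suc n = ≈-trans (mk≈ λ i → cong (λ m → (q · X m) i) (ℕ.+-suc n n))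
  (solve 2 (λ q e → q :* (q :* e) := e :* (q :* q)) ≈-refl q (X² n))

oddX : ℕ → PowerSeries
oddX n = q · X² n

denominator : PowerSeries → PowerSeries → ℕ → PowerSeries
denominator σ s n = const 1ℤ ⊝ σ · s · oddX n

Monic-denominator : ∀ σ s n → Monic (denominator σ s n)
Monic-denominator σ s n = Monic-1⊝ (σ · s · oddX n) (·-zeroʳ (σ · s) (oddX n) (q·-zero (X² n)))

-- H σ s n = ∏_{i=1}^{n} σ q^{2i-1} (q^{2i-1} + s)/(1 - σ s q^{2i-1}).  For s = ±q^{2N} and σ = ±1
-- these are the terms n ≥ 0 of a well-poised bilateral series; those with n < 0 arise from
-- s ↦ -σ s.
H : PowerSeries → PowerSeries → ℕ → PowerSeries
H σ s zero    = const 1ℤ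
H σ s (suc n) = H σ s n · (σ · oddX n · (oddX n ⊕ s) · inv (denominator σ s n))

H-suc : ∀ σ s n → denominator σ s n · H σ s (suc n) ≈ σ · oddX n · (oddX n ⊕ s) · H σ s n
H-suc σ s n = begin
  d · (h · (f · inv d)) ≈⟨ solve 4 (λ d h f i → d :* (h :* (f :* i)) := (i :* d) :* (f :* h)) ≈-refl d h f (inv d) ⟩
  inv d · d · (f · h)   ≈⟨ ·-congʳ (f · h) (inv-inverse d (Monic-denominator σ s n)) ⟩
  const 1ℤ · (f · h)    ≈⟨ solve 2 (λ f h → con 1ℤ :* (f :* h) := f :* h) ≈-refl f h ⟩
  f · h                 ∎
  where
  open ≈-Reasoning
  d h f : PowerSeries
  d = denominator σ s n
  h = H σ s n
  f = σ · oddX n · (oddX n ⊕ s)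

-- A first-order recurrence with invertible leading coefficient has a single solution. Every
-- identification of a concrete family with `H` uses this.
H-unique : ∀ σ s (h : ℕ → PowerSeries) → h 0 ≈ const 1ℤ →
           (∀ n → denominator σ s n · h (suc n) ≈ σ · oddX n · (oddX n ⊕ s) · h n) →
           ∀ n → h n ≈ H σ s n
H-unique σ s h h₀ h-suc zero    = h₀
H-unique σ s h h₀ h-suc (suc n) = cancel (denominator σ s n) (Monic-denominator σ s n)
  (≈-trans (h-suc n) (≈-trans (·-congˡ _ (H-unique σ s h h₀ h-suc n)) (≈-sym (H-suc σ s n))))

H-cong : ∀ σ {s s′} → s ≈ s′ → ∀ n → H σ s n ≈ H σ s′ n
H-cong σ {s} {s′} p = H-unique σ s′ (H σ s) ≈-refl λ n → begin
  denominator σ s′ n · H σ s (suc n)    ≈⟨ ·-congʳ _ (⊝-cong ≈-refl (·-congʳ (oddX n) (·-congˡ σ p))) ⟨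
  denominator σ s n · H σ s (suc n)     ≈⟨ H-suc σ s n ⟩
  σ · oddX n · (oddX n ⊕ s) · H σ s n   ≈⟨ ·-congʳ _ (·-congˡ _ (⊕-cong ≈-refl p)) ⟩
  σ · oddX n · (oddX n ⊕ s′) · H σ s n  ∎
  where open ≈-Reasoning

H-order : ∀ σ s n → ∃[ g ] H σ s n ≈ X n · g
H-order σ s zero    = const 1ℤ , solve 0 (con 1ℤ := con 1ℤ :* con 1ℤ) ≈-refl
H-order σ s (suc n) with H-order σ s n
... | g , p = g · (σ · X² n · (oddX n ⊕ s) · inv (denominator σ s n)) , ≈-trans (·-congʳ _ p)
  (solve 7 (λ x g σ e s i q → x :* g :* (σ :* (q :* e) :* ((q :* e) :+ s) :* i)
                           := q :* x :* (g :* (σ :* e :* ((q :* e) :+ s) :* i))) ≈-refl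
     (X n) g σ (X² n) s (inv (denominator σ s n)) q)

-- Multiplied by q^{2n}, so that no negative power of q occurs.
H-shift : ∀ σ s n → X² n · ((const 1ℤ ⊕ s · q) · (const 1ℤ ⊝ σ · (s · q))) · H σ s n
                  ≈ (X² n ⊕ s · q) · (const 1ℤ ⊝ σ · (s · q) · X² n) · H σ (s · (q · q)) n
H-shift σ s zero    = solve 2 (λ σ y →
    con 1ℤ :* ((con 1ℤ :+ y) :* (con 1ℤ :- σ :* y)) :* con 1ℤ
    := (con 1ℤ :+ y) :* (con 1ℤ :- σ :* y :* con 1ℤ) :* con 1ℤ) ≈-refl σ (s · q)
H-shift σ s (suc n) = cancel (denominator σ s n) (Monic-denominator σ s n) (begin
  d · (X² (suc n) · C · a′)
    ≈⟨ ·-congˡ d (·-congʳ a′ (·-congʳ C (X²-suc n))) ⟩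
  d · (e · Q · C · a′)
    ≈⟨ solve 5 (λ d e Q C a → d :* (e :* Q :* C :* a) := e :* Q :* C :* (d :* a)) ≈-refl d e Q C a′ ⟩
  e · Q · C · (d · a′)
    ≈⟨ ·-congˡ (e · Q · C) (H-suc σ s n) ⟩
  e · Q · C · (σ · p · (p ⊕ s) · a)
    ≈⟨ solve 7 (λ e Q C σ p s a → e :* Q :* C :* (σ :* p :* (p :+ s) :* a) := Q :* σ :* p :* (p :+ s) :* (e :* C :* a)) ≈-refl e Q C σ p s a ⟩
  Q · σ · p · (p ⊕ s) · (e · C · a)
    ≈⟨ ·-congˡ (Q · σ · p · (p ⊕ s)) (H-shift σ s n) ⟩
  Q · σ · p · (p ⊕ s) · ((e ⊕ y) · (const 1ℤ ⊝ σ · y · e) · b)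
    ≈⟨ solve 5 (λ σ s q e b → (q :* q) :* σ :* (q :* e) :* ((q :* e) :+ s) :* ((e :+ s :* q) :* (con 1ℤ :- σ :* (s :* q) :* e) :* b)
                 := (con 1ℤ :- σ :* (s :* q) :* e) :* (e :* (q :* q) :+ s :* q) :* (σ :* (q :* e) :* (q :* e :+ s :* (q :* q)) :* b)) ≈-refl σ s q e b ⟩
  (const 1ℤ ⊝ σ · y · e) · (e · Q ⊕ y) · (σ · p · (p ⊕ s · Q) · b)
    ≈⟨ ·-congˡ ((const 1ℤ ⊝ σ · y · e) · (e · Q ⊕ y)) (H-suc σ (s · Q) n) ⟨
  (const 1ℤ ⊝ σ · y · e) · (e · Q ⊕ y) · (denominator σ (s · Q) n · b′)
    ≈⟨ solve 5 (λ σ s q e b → (con 1ℤ :- σ :* (s :* q) :* e) :* (e :* (q :* q) :+ s :* q) :* ((con 1ℤ :- σ :* (s :* (q :* q)) :* (q :* e)) :* b)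
                 := (con 1ℤ :- σ :* s :* (q :* e)) :* ((e :* (q :* q) :+ s :* q) :* (con 1ℤ :- σ :* (s :* q) :* (e :* (q :* q))) :* b)) ≈-refl σ s q e b′ ⟩
  d · ((e · Q ⊕ y) · (const 1ℤ ⊝ σ · y · (e · Q)) · b′)
    ≈⟨ ·-congˡ d (·-congʳ b′ (·-cong (⊕-cong (X²-suc n) ≈-refl) (⊝-cong ≈-refl (·-congˡ (σ · y) (X²-suc n))))) ⟨
  d · ((X² (suc n) ⊕ y) · (const 1ℤ ⊝ σ · y · X² (suc n)) · b′) ∎)
  where
  open ≈-Reasoning
  d e p Q y C a a′ b b′ : PowerSeries
  d = denominator σ s n
  e = X² n
  p = oddX n
  Q = q · q
  y = s · q
  C = (const 1ℤ ⊕ y) · (const 1ℤ ⊝ σ · y)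
  a = H σ s n
  a′ = H σ s (suc n)
  b = H σ (s · Q) n
  b′ = H σ (s · Q) (suc n)

-- The certificate is `Γ M = σ y (q^{2M} + y) H σ (s q²) M`: by `increment`, `A` times a term of the
-- left sum exceeds `C` times the same term of the right sum by a difference of consecutive values
-- of `Γ`. The case `M = 0` fixes the constant `y (1 - σ y)`.
telescope : ∀ σ s M → let y = s · q in
  (const 1ℤ ⊕ σ · (y · y)) · psum (H σ (s · (q · q))) (suc M)
  ≈ (const 1ℤ ⊕ y) · (const 1ℤ ⊝ σ · y) · psum (H σ s) (suc M)
    ⊕ (σ · y · (X² M ⊕ y) · H σ (s · (q · q)) M ⊝ y · (const 1ℤ ⊝ σ · y))
telescope σ s zero    = solve 2 (λ σ y →
  (con 1ℤ :+ σ :* (y :* y)) :* (con 0ℤ :+ con 1ℤ)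
  := (con 1ℤ :+ y) :* (con 1ℤ :- σ :* y) :* (con 0ℤ :+ con 1ℤ)
     :+ (σ :* y :* (con 1ℤ :+ y) :* con 1ℤ :- y :* (con 1ℤ :- σ :* y))) ≈-refl σ (s · q)
telescope σ s (suc M) = begin
  A · (Σ′ ⊕ b′)
    ≈⟨ solve 3 (λ A S b → A :* (S :+ b) := A :* S :+ A :* b) ≈-refl A Σ′ b′ ⟩
  A · Σ′ ⊕ A · b′
    ≈⟨ ⊕-cong (telescope σ s M) increment ⟩
  C · Σ ⊕ (Γ ⊝ r) ⊕ (C · a′ ⊕ (Γ′ ⊝ Γ))
    ≈⟨ solve 6 (λ C S G G′ r a → C :* S :+ (G :- r) :+ (C :* a :+ (G′ :- G)) := C :* (S :+ a) :+ (G′ :- r)) ≈-refl C Σ Γ Γ′ r a′ ⟩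
  C · (Σ ⊕ a′) ⊕ (Γ′ ⊝ r) ∎
  where
  open ≈-Reasoning
  e E Q y A C a′ b b′ Σ Σ′ Γ Γ′ r : PowerSeries
  e = X² M
  E = X² (suc M)
  Q = q · q
  y = s · q
  A = const 1ℤ ⊕ σ · (y · y)
  C = (const 1ℤ ⊕ y) · (const 1ℤ ⊝ σ · y)
  a′ = H σ s (suc M)
  b = H σ (s · Q) M
  b′ = H σ (s · Q) (suc M)
  Σ = psum (H σ s) (suc M)
  Σ′ = psum (H σ (s · Q)) (suc M)
  Γ = σ · y · (e ⊕ y) · b
  Γ′ = σ · y · (E ⊕ y) · b′
  r = y · (const 1ℤ ⊝ σ · y)
  -- With `p = oddX M`, `p (p + s q²) = q^{2M+2} (q^{2M} + y)`, so `E · Γ` contains the numerator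
  -- that leads from `b` to `b′`.
  E·Γ : E · Γ ≈ y · (const 1ℤ ⊝ σ · y · E) · b′
  E·Γ = begin
    E · Γ
      ≈⟨ ·-congʳ Γ (X²-suc M) ⟩
    e · Q · Γ
      ≈⟨ solve 5 (λ σ s q e b → e :* (q :* q) :* (σ :* (s :* q) :* (e :+ s :* q) :* b)
            := s :* q :* (σ :* (q :* e) :* (q :* e :+ s :* (q :* q)) :* b)) ≈-refl σ s q e b ⟩
    y · (σ · oddX M · (oddX M ⊕ s · Q) · b)
      ≈⟨ ·-congˡ y (H-suc σ (s · Q) M) ⟨
    y · (denominator σ (s · Q) M · b′)
      ≈⟨ solve 5 (λ σ s q e b → s :* q :* ((con 1ℤ :- σ :* (s :* (q :* q)) :* (q :* e)) :* b)
            := s :* q :* (con 1ℤ :- σ :* (s :* q) :* (e :* (q :* q))) :* b) ≈-refl σ s q e b′ ⟩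
    y · (const 1ℤ ⊝ σ · y · (e · Q)) · b′
      ≈⟨ ·-congʳ b′ (·-congˡ y (⊝-cong ≈-refl (·-congˡ (σ · y) (X²-suc M)))) ⟨
    y · (const 1ℤ ⊝ σ · y · E) · b′ ∎
  increment : A · b′ ≈ C · a′ ⊕ (Γ′ ⊝ Γ)
  -- Both `H-shift` and `E·Γ` carry the factor `q^{2M+2}`, which is divided out at the end.
  increment = X-cancel (suc M + suc M) (≈-sym (begin
    E · (C · a′ ⊕ (Γ′ ⊝ Γ))
      ≈⟨ solve 5 (λ E C a G′ G → E :* (C :* a :+ (G′ :- G)) := E :* C :* a :+ (E :* G′ :- E :* G)) ≈-refl E C a′ Γ′ Γ ⟩
    E · C · a′ ⊕ (E · Γ′ ⊝ E · Γ)
      ≈⟨ ⊕-cong (H-shift σ s (suc M)) (⊝-cong ≈-refl E·Γ) ⟩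
    (E ⊕ y) · (const 1ℤ ⊝ σ · y · E) · b′ ⊕ (E · Γ′ ⊝ y · (const 1ℤ ⊝ σ · y · E) · b′)
      ≈⟨ solve 4 (λ σ y E b → (E :+ y) :* (con 1ℤ :- σ :* y :* E) :* b :+ (E :* (σ :* y :* (E :+ y) :* b) :- y :* (con 1ℤ :- σ :* y :* E) :* b)
            := E :* ((con 1ℤ :+ σ :* (y :* y)) :* b)) ≈-refl σ y E b′ ⟩
    E · (A · b′) ∎))

telescope[] : ∀ K σ s {s′} → s′ ≈ s · (q · q) → let y = s · q in
  (const 1ℤ ⊕ σ · (y · y)) · psum (H σ s′) (suc K)
  ≈[ K ] (const 1ℤ ⊕ y) · (const 1ℤ ⊝ σ · y) · psum (H σ s) (suc K) ⊝ y · (const 1ℤ ⊝ σ · y)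
telescope[] K σ s {s′} s′≈ with H-order σ (s · (q · q)) K
... | g , order = begin
  A · psum (H σ s′) (suc K)
    ≈⟨ trunc (·-congˡ A (psum-cong (H-cong σ s′≈) (suc K))) ⟩
  A · psum (H σ (s · (q · q))) (suc K)
    ≈⟨ trunc (telescope σ s K) ⟩
  C · Σ ⊕ (γ · H σ (s · (q · q)) K ⊝ r)
    -- The upper boundary term contains the `K`-th term of the sum, which is divisible by `q^K`.
    ≈⟨ []-⊕ []-refl ([]-⊕ ([]-·ˡ γ ([]-trans (trunc order) (X·≈[]0 K K g ℕ.≤-refl))) []-refl) ⟩
  C · Σ ⊕ (γ · const 0ℤ ⊝ r)
    ≈⟨ trunc (solve 4 (λ C Σ γ r → C :* Σ :+ (γ :* con 0ℤ :- r) := C :* Σ :- r) ≈-refl C Σ γ r) ⟩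
  C · Σ ⊝ r ∎
  where
  open Mod K
  y A C Σ γ r : PowerSeries
  y = s · q
  A = const 1ℤ ⊕ σ · (y · y)
  C = (const 1ℤ ⊕ y) · (const 1ℤ ⊝ σ · y)
  Σ = psum (H σ s) (suc K)
  γ = σ · y · (X² K ⊕ y)
  r = y · (const 1ℤ ⊝ σ · y)

-- The recurrences in N and their product form

-- These are `(-q;q²)ₙ` and `(q;q²)ₙ`.
P₊ P₋ : ℕ → PowerSeries
P₊ zero    = const 1ℤ
P₊ (suc n) = P₊ n · (const 1ℤ ⊕ oddX n)
P₋ zero    = const 1ℤ
P₋ (suc n) = P₋ n · (const 1ℤ ⊝ oddX n)

Monic-P₊ : ∀ n → Monic (P₊ n)
Monic-P₊ zero    = refl
Monic-P₊ (suc n) = Monic-· (P₊ n) _ (Monic-P₊ n) (Monic-1⊕ (oddX n) (q·-zero (X² n)))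

Monic-P₋ : ∀ n → Monic (P₋ n)
Monic-P₋ zero    = refl
Monic-P₋ (suc n) = Monic-· (P₋ n) _ (Monic-P₋ n) (Monic-1⊝ (oddX n) (q·-zero (X² n)))

D-X : ∀ m → D (X m) ≈ X m · X m
D-X zero    = ≈-trans (D-const 1ℤ) (solve 0 (con 1ℤ := con 1ℤ :* con 1ℤ) ≈-refl)
D-X (suc m) = ≈-trans (D-· q (X m)) (≈-trans (·-cong D-q (D-X m))
  (solve 2 (λ q x → q :* q :* (x :* x) := q :* x :* (q :* x)) ≈-refl q (X m)))

N-oddX : ∀ n → N (oddX n) ≈ ⊖ oddX n
N-oddX n = begin
  N (q · X² n)      ≈⟨ N-· q (X² n) ⟩
  N q · N (X² n)    ≈⟨ ·-cong N-q (N-cong X²-D) ⟩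
  ⊖ q · N (D (X n)) ≈⟨ ·-congˡ (⊖ q) (N-D (X n)) ⟩
  ⊖ q · D (X n)     ≈⟨ ·-congˡ (⊖ q) X²-D ⟨
  ⊖ q · X² n        ≈⟨ solve 2 (λ q e → (:- q) :* e := :- (q :* e)) ≈-refl q (X² n) ⟩
  ⊖ oddX n          ∎
  where
  open ≈-Reasoning
  X²-D : X² n ≈ D (X n)
  X²-D = ≈-trans (X-+ n n) (≈-sym (D-X n))

D-1⊕ : ∀ f → D (const 1ℤ ⊕ f) ≈ const 1ℤ ⊕ D f
D-1⊕ f = ≈-trans (D-⊕ (const 1ℤ) f) (⊕-cong (D-const 1ℤ) ≈-refl)

D-⊝ : ∀ f g → D (f ⊝ g) ≈ D f ⊝ D g
D-⊝ f g = ≈-trans (D-⊕ f (⊖ g)) (⊕-cong ≈-refl (D-⊖ g))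

N-⊝ : ∀ f g → N (f ⊝ g) ≈ N f ⊝ N g
N-⊝ f g = ≈-trans (N-⊕ f (⊖ g)) (⊕-cong ≈-refl (N-⊖ g))

N-P₊ : ∀ n → N (P₊ n) ≈ P₋ n
N-P₊ zero    = N-const 1ℤ
N-P₊ (suc n) = ≈-trans (N-· (P₊ n) _) (·-cong (N-P₊ n)
  (≈-trans (N-⊕ (const 1ℤ) (oddX n)) (⊕-cong (N-const 1ℤ) (N-oddX n))))

D-1⊝oddX : ∀ n → D (const 1ℤ ⊝ oddX n) ≈ (const 1ℤ ⊝ oddX n) · (const 1ℤ ⊕ oddX n)
D-1⊝oddX n = ≈-trans (D-⊝ (const 1ℤ) (oddX n)) (≈-trans (⊝-cong (D-const 1ℤ) (D-X (suc (n + n))))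
  (solve 1 (λ u → con 1ℤ :- u :* u := (con 1ℤ :- u) :* (con 1ℤ :+ u)) ≈-refl (oddX n)))

D-1⊕oddX : ∀ n → D (const 1ℤ ⊕ oddX n) ≈ const 1ℤ ⊕ oddX n · oddX n
D-1⊕oddX n = ≈-trans (D-1⊕ (oddX n)) (⊕-cong ≈-refl (D-X (suc (n + n))))

-- Truncated bilateral series, the index playing the role of `N`; the subtracted 1 is the central
-- term, counted in both halves. In `S₂`, where `σ = -1`, the map `s ↦ -σ s` is the identity, so the
-- halves coincide.
S₁ S₂ : ℕ → ℕ → PowerSeries
S₁ K n = psum (H (const 1ℤ) (X² n)) (suc K) ⊕ psum (H (const 1ℤ) (⊖ X² n)) (suc K) ⊝ const 1ℤ
S₂ K n = const (+ 2) · psum (H (const -1ℤ) (⊖ X² n)) (suc K) ⊝ const 1ℤ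

-- The halves have opposite `y`, hence the same `A = 1 + y²` and `C = 1 - y²`. Their boundary terms
-- `-y (1 - y)` and `y (1 + y)` add up to `2y²`, which changes `-(1 + y²)` into `-(1 - y²)`. Both
-- factors are images under `D`, so that `D` can be undone in `W-product`.
S₁-suc : ∀ K n → D (const 1ℤ ⊕ oddX n) · S₁ K (suc n) ≈[ K ] D (const 1ℤ ⊝ oddX n) · S₁ K n
S₁-suc K n = begin
  D (const 1ℤ ⊕ oddX n) · (Σ₊′ ⊕ Σ₋′ ⊝ const 1ℤ)
    ≈⟨ trunc (·-congʳ _ (D-1⊕oddX n)) ⟩
  (const 1ℤ ⊕ oddX n · oddX n) · (Σ₊′ ⊕ Σ₋′ ⊝ const 1ℤ)
    ≈⟨ trunc (solve 4 (λ q e a b → (con 1ℤ :+ (q :* e) :* (q :* e)) :* (a :+ b :- con 1ℤ)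
         := (con 1ℤ :+ con 1ℤ :* ((e :* q) :* (e :* q))) :* a
            :+ (con 1ℤ :+ con 1ℤ :* (((:- e) :* q) :* ((:- e) :* q))) :* b
            :- (con 1ℤ :+ (q :* e) :* (q :* e))) ≈-refl q (X² n) Σ₊′ Σ₋′) ⟩
  A (X² n · q) · Σ₊′ ⊕ A (⊖ X² n · q) · Σ₋′ ⊝ (const 1ℤ ⊕ oddX n · oddX n)
    ≈⟨ []-⊕ ([]-⊕ (telescope[] K (const 1ℤ) (X² n) (X²-suc n)) (telescope[] K (const 1ℤ) (⊖ X² n) neg)) []-refl ⟩
  (C (X² n · q) · Σ₊ ⊝ r (X² n · q)) ⊕ (C (⊖ X² n · q) · Σ₋ ⊝ r (⊖ X² n · q)) ⊝ (const 1ℤ ⊕ oddX n · oddX n)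
    ≈⟨ trunc (solve 4 (λ q e a b →
         ((con 1ℤ :+ e :* q) :* (con 1ℤ :- con 1ℤ :* (e :* q)) :* a :- (e :* q) :* (con 1ℤ :- con 1ℤ :* (e :* q)))
         :+ ((con 1ℤ :+ (:- e) :* q) :* (con 1ℤ :- con 1ℤ :* ((:- e) :* q)) :* b :- ((:- e) :* q) :* (con 1ℤ :- con 1ℤ :* ((:- e) :* q)))
         :- (con 1ℤ :+ (q :* e) :* (q :* e))
         := (con 1ℤ :- q :* e) :* (con 1ℤ :+ q :* e) :* (a :+ b :- con 1ℤ)) ≈-refl q (X² n) Σ₊ Σ₋) ⟩
  (const 1ℤ ⊝ oddX n) · (const 1ℤ ⊕ oddX n) · (Σ₊ ⊕ Σ₋ ⊝ const 1ℤ)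
    ≈⟨ trunc (·-congʳ _ (D-1⊝oddX n)) ⟨
  D (const 1ℤ ⊝ oddX n) · (Σ₊ ⊕ Σ₋ ⊝ const 1ℤ) ∎
  where
  open Mod K
  Σ₊ Σ₋ Σ₊′ Σ₋′ : PowerSeries
  Σ₊ = psum (H (const 1ℤ) (X² n)) (suc K)
  Σ₋ = psum (H (const 1ℤ) (⊖ X² n)) (suc K)
  Σ₊′ = psum (H (const 1ℤ) (X² (suc n))) (suc K)
  Σ₋′ = psum (H (const 1ℤ) (⊖ X² (suc n))) (suc K)
  A C r : PowerSeries → PowerSeries
  A y = const 1ℤ ⊕ const 1ℤ · (y · y)
  C y = (const 1ℤ ⊕ y) · (const 1ℤ ⊝ const 1ℤ · y)
  r y = y · (const 1ℤ ⊝ const 1ℤ · y)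
  neg : ⊖ X² (suc n) ≈ ⊖ X² n · (q · q)
  neg = ≈-trans (⊖-cong (X²-suc n)) (solve 2 (λ e Q → :- (e :* Q) := (:- e) :* Q) ≈-refl (X² n) (q · q))

-- Here `A = (1 - u)(1 + u)` and `C = (1 - u)²` with `u = oddX n`. The common factor is carried
-- along; `φ-product` cancels its accumulated product `P₋`.
S₂-suc : ∀ K n → let 1-u = const 1ℤ ⊝ oddX n in
  1-u · (const 1ℤ ⊕ oddX n) · S₂ K (suc n) ≈[ K ] 1-u · 1-u · S₂ K n
S₂-suc K n = begin
  (const 1ℤ ⊝ oddX n) · (const 1ℤ ⊕ oddX n) · (const (+ 2) · Σ′ ⊝ const 1ℤ)
    ≈⟨ trunc (solve 3 (λ q e a → (con 1ℤ :- q :* e) :* (con 1ℤ :+ q :* e) :* (con (+ 2) :* a :- con 1ℤ)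
         := con (+ 2) :* ((con 1ℤ :+ con -1ℤ :* (((:- e) :* q) :* ((:- e) :* q))) :* a)
            :- (con 1ℤ :- q :* e) :* (con 1ℤ :+ q :* e)) ≈-refl q (X² n) Σ′) ⟩
  const (+ 2) · ((const 1ℤ ⊕ const -1ℤ · (y · y)) · Σ′) ⊝ (const 1ℤ ⊝ oddX n) · (const 1ℤ ⊕ oddX n)
    ≈⟨ []-⊕ ([]-·ˡ (const (+ 2)) (telescope[] K (const -1ℤ) (⊖ X² n) neg)) []-refl ⟩
  const (+ 2) · ((const 1ℤ ⊕ y) · (const 1ℤ ⊝ const -1ℤ · y) · Σ ⊝ y · (const 1ℤ ⊝ const -1ℤ · y)) ⊝ (const 1ℤ ⊝ oddX n) · (const 1ℤ ⊕ oddX n)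
    ≈⟨ trunc (solve 3 (λ q e a → con (+ 2) :* ((con 1ℤ :+ (:- e) :* q) :* (con 1ℤ :- con -1ℤ :* ((:- e) :* q)) :* a
                 :- ((:- e) :* q) :* (con 1ℤ :- con -1ℤ :* ((:- e) :* q))) :- (con 1ℤ :- q :* e) :* (con 1ℤ :+ q :* e)
         := (con 1ℤ :- q :* e) :* (con 1ℤ :- q :* e) :* (con (+ 2) :* a :- con 1ℤ)) ≈-refl q (X² n) Σ) ⟩
  (const 1ℤ ⊝ oddX n) · (const 1ℤ ⊝ oddX n) · (const (+ 2) · Σ ⊝ const 1ℤ) ∎
  where
  open Mod K
  y Σ Σ′ : PowerSeries
  y = ⊖ X² n · q
  Σ = psum (H (const -1ℤ) (⊖ X² n)) (suc K)
  Σ′ = psum (H (const -1ℤ) (⊖ X² (suc n))) (suc K)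
  neg : ⊖ X² (suc n) ≈ ⊖ X² n · (q · q)
  neg = ≈-trans (⊖-cong (X²-suc n)) (solve 2 (λ e Q → :- (e :* Q) := (:- e) :* Q) ≈-refl (X² n) (q · q))

S₁-product : ∀ K n → D (P₊ n) · S₁ K n ≈[ K ] D (P₋ n) · S₁ K 0
S₁-product K zero    = Mod.[]-refl K
S₁-product K (suc n) = begin
  D (P₊ n · f₊) · S₁ K (suc n)
    ≈⟨ trunc (·-congʳ _ (D-· (P₊ n) f₊)) ⟩
  D (P₊ n) · D f₊ · S₁ K (suc n)
    ≈⟨ trunc (solve 3 (λ a b c → a :* b :* c := a :* (b :* c)) ≈-refl (D (P₊ n)) (D f₊) (S₁ K (suc n))) ⟩
  D (P₊ n) · (D f₊ · S₁ K (suc n))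
    ≈⟨ []-·ˡ _ (S₁-suc K n) ⟩
  D (P₊ n) · (D f₋ · S₁ K n)
    ≈⟨ trunc (solve 3 (λ a b c → a :* (b :* c) := b :* (a :* c)) ≈-refl (D (P₊ n)) (D f₋) (S₁ K n)) ⟩
  D f₋ · (D (P₊ n) · S₁ K n)
    ≈⟨ []-·ˡ _ (S₁-product K n) ⟩
  D f₋ · (D (P₋ n) · S₁ K 0)
    ≈⟨ trunc (solve 3 (λ a b c → b :* (a :* c) := a :* b :* c) ≈-refl (D (P₋ n)) (D f₋) (S₁ K 0)) ⟩
  D (P₋ n) · D f₋ · S₁ K 0
    ≈⟨ trunc (·-congʳ _ (D-· (P₋ n) f₋)) ⟨
  D (P₋ n · f₋) · S₁ K 0 ∎
  where
  open Mod K
  f₊ f₋ : PowerSeries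
  f₊ = const 1ℤ ⊕ oddX n
  f₋ = const 1ℤ ⊝ oddX n

S₂-product : ∀ K n → P₋ n · P₊ n · S₂ K n ≈[ K ] P₋ n · P₋ n · S₂ K 0
S₂-product K zero    = Mod.[]-refl K
S₂-product K (suc n) = begin
  P₋ n · f₋ · (P₊ n · f₊) · S₂ K (suc n)
    ≈⟨ trunc (solve 5 (λ a b c d s → a :* c :* (b :* d) :* s := a :* b :* (c :* d :* s)) ≈-refl (P₋ n) (P₊ n) f₋ f₊ (S₂ K (suc n))) ⟩
  P₋ n · P₊ n · (f₋ · f₊ · S₂ K (suc n))
    ≈⟨ []-·ˡ _ (S₂-suc K n) ⟩
  P₋ n · P₊ n · (f₋ · f₋ · S₂ K n)
    ≈⟨ trunc (solve 4 (λ a b c s → a :* b :* (c :* c :* s) := c :* c :* (a :* b :* s)) ≈-refl (P₋ n) (P₊ n) f₋ (S₂ K n)) ⟩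
  f₋ · f₋ · (P₋ n · P₊ n · S₂ K n)
    ≈⟨ []-·ˡ _ (S₂-product K n) ⟩
  f₋ · f₋ · (P₋ n · P₋ n · S₂ K 0)
    ≈⟨ trunc (solve 3 (λ a c s → c :* c :* (a :* a :* s) := a :* c :* (a :* c) :* s) ≈-refl (P₋ n) f₋ (S₂ K 0)) ⟩
  P₋ n · f₋ · (P₋ n · f₋) · S₂ K 0 ∎
  where
  open Mod K
  f₊ f₋ : PowerSeries
  f₊ = const 1ℤ ⊕ oddX n
  f₋ = const 1ℤ ⊝ oddX n

-- Theta series

-- `q^{n²}` as the product of the first `n` odd powers of `q`, which gives it a recurrence of the
-- type of `H`.
T : ℕ → PowerSeries
T zero    = const 1ℤ
T (suc n) = T n · oddX n

T-order : ∀ n → ∃[ g ] T n ≈ X n · g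
T-order zero    = const 1ℤ , solve 0 (con 1ℤ := con 1ℤ :* con 1ℤ) ≈-refl
T-order (suc n) with T-order n
... | g , p = g · X² n , ≈-trans (·-congʳ _ p)
  (solve 4 (λ x g q e → x :* g :* (q :* e) := q :* x :* (g :* e)) ≈-refl (X n) g q (X² n))

-- `Θ` is the one-sided theta series, the indicator of the squares that the theorem asks for; `φ` is
-- the two-sided one.
Θ φ : PowerSeries
Θ = total T
φ = const (+ 2) · Θ ⊝ const 1ℤ

φ-partial : ℕ → PowerSeries
φ-partial K = const (+ 2) · psum T (suc K) ⊝ const 1ℤ

φ-partial≈[]φ : ∀ K → φ-partial K ≈[ K ] φ
φ-partial≈[]φ K = []-⊕ ([]-·ˡ _ (psum≈[]total K T T-order)) []-refl
  where open Mod K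

-- The terms of `H` at `s = 0`, where the denominators are 1.
limit : PowerSeries → ℕ → PowerSeries
limit σ zero    = const 1ℤ
limit σ (suc n) = limit σ n · (σ · (oddX n · oddX n))

H≈[]limit : ∀ K σ {s} → s ≈[ K ] const 0ℤ → ∀ n → H σ s n ≈[ K ] limit σ n
H≈[]limit K σ {s} s≈0 zero    = Mod.[]-refl K
H≈[]limit K σ {s} s≈0 (suc n) = []-· (H≈[]limit K σ s≈0 n) (begin
  σ · p · (p ⊕ s) · inv d
    ≈⟨ []-·ʳ (inv d) ([]-·ˡ (σ · p) ([]-⊕ []-refl s≈0)) ⟩
  σ · p · (p ⊕ const 0ℤ) · inv d
    ≈⟨ trunc (solve 3 (λ σ p i → σ :* p :* (p :+ con 0ℤ) :* i := σ :* (p :* p) :* (i :* con 1ℤ)) ≈-refl σ p (inv d)) ⟩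
  σ · (p · p) · (inv d · const 1ℤ)
    ≈⟨ []-·ˡ _ ([]-·ˡ (inv d) ([]-trans ([]-⊕ []-refl ([]-⊖ ([]-·ʳ p ([]-·ˡ σ s≈0))))
          (trunc (solve 2 (λ σ p → con 1ℤ :- σ :* con 0ℤ :* p := con 1ℤ) ≈-refl σ p)))) ⟨
  σ · (p · p) · (inv d · d)
    ≈⟨ trunc (·-congˡ _ (inv-inverse d (Monic-denominator σ s n))) ⟩
  σ · (p · p) · const 1ℤ
    ≈⟨ trunc (solve 1 (λ x → x :* con 1ℤ := x) ≈-refl (σ · (p · p))) ⟩
  σ · (p · p) ∎)
  where
  open Mod K
  p d : PowerSeries
  p = oddX n
  d = denominator σ s n

limit-1 : ∀ n → limit (const 1ℤ) n ≈ D (T n)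
limit-1 zero    = ≈-sym (D-const 1ℤ)
limit-1 (suc n) = ≈-trans (·-cong (limit-1 n)
    (≈-trans (solve 1 (λ p → con 1ℤ :* (p :* p) := p :* p) ≈-refl (oddX n)) (≈-sym (D-X (suc (n + n))))))
  (≈-sym (D-· (T n) (oddX n)))

-- The sign `(-1)ⁿ` is produced by `N`, because `n` and `n²` have the same parity.
limit-neg1 : ∀ n → limit (const -1ℤ) n ≈ D (N (T n))
limit-neg1 zero    = ≈-sym (≈-trans (D-cong (N-const 1ℤ)) (D-const 1ℤ))
limit-neg1 (suc n) = ≈-trans (·-cong (limit-neg1 n) (begin
    const -1ℤ · (oddX n · oddX n) ≈⟨ solve 1 (λ p → con -1ℤ :* (p :* p) := :- (p :* p)) ≈-refl (oddX n) ⟩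
    ⊖ (oddX n · oddX n)           ≈⟨ ⊖-cong (D-X (suc (n + n))) ⟨
    ⊖ D (oddX n)                  ≈⟨ D-⊖ (oddX n) ⟨
    D (⊖ oddX n)                  ≈⟨ D-cong (N-oddX n) ⟨
    D (N (oddX n))                ∎))
  (≈-trans (≈-sym (D-· (N (T n)) (N (oddX n)))) (D-cong (≈-sym (N-· (T n) (oddX n)))))
  where open ≈-Reasoning

X²≈[]0 : ∀ K → X² K ≈[ K ] const 0ℤ
X²≈[]0 K = []-trans (trunc (X-+ K K)) (X·≈[]0 K K (X K) ℕ.≤-refl)
  where open Mod K

⊖X²≈[]0 : ∀ K → ⊖ X² K ≈[ K ] const 0ℤ
⊖X²≈[]0 K = []-trans ([]-⊖ (X²≈[]0 K)) (trunc (solve 0 (:- con 0ℤ := con 0ℤ) ≈-refl))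
  where open Mod K

D-affine : ∀ f → const (+ 2) · D f ⊝ const 1ℤ ≈ D (const (+ 2) · f ⊝ const 1ℤ)
D-affine f = ≈-sym (≈-trans (D-⊝ (const (+ 2) · f) (const 1ℤ))
  (⊝-cong (≈-trans (D-· (const (+ 2)) f) (·-congʳ (D f) (D-const (+ 2)))) (D-const 1ℤ)))

N-affine : ∀ f → const (+ 2) · N f ⊝ const 1ℤ ≈ N (const (+ 2) · f ⊝ const 1ℤ)
N-affine f = ≈-sym (≈-trans (N-⊝ (const (+ 2) · f) (const 1ℤ))
  (⊝-cong (≈-trans (N-· (const (+ 2)) f) (·-congʳ (N f) (N-const (+ 2)))) (N-const 1ℤ)))

-- One index serves as truncation and as shift: `q^{2K}` vanishes modulo `q^K`.
S₁-limit : ∀ K → S₁ K K ≈[ K ] D φ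
S₁-limit K = begin
  S₁ K K
    ≈⟨ []-⊕ ([]-⊕ (psum-cong[] (H≈[]limit K (const 1ℤ) (X²≈[]0 K)) (suc K))
                  (psum-cong[] (H≈[]limit K (const 1ℤ) (⊖X²≈[]0 K)) (suc K))) []-refl ⟩
  ℓ ⊕ ℓ ⊝ const 1ℤ
    ≈⟨ trunc (solve 1 (λ x → x :+ x :- con 1ℤ := con (+ 2) :* x :- con 1ℤ) ≈-refl ℓ) ⟩
  const (+ 2) · ℓ ⊝ const 1ℤ
    ≈⟨ trunc (⊝-cong (·-congˡ _ (≈-trans (psum-cong limit-1 (suc K)) (psum-D T (suc K)))) ≈-refl) ⟩
  const (+ 2) · D (psum T (suc K)) ⊝ const 1ℤ
    ≈⟨ trunc (D-affine (psum T (suc K))) ⟩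
  D (φ-partial K)
    ≈⟨ D-cong[] (φ-partial≈[]φ K) ⟩
  D φ ∎
  where
  open Mod K
  ℓ : PowerSeries
  ℓ = psum (limit (const 1ℤ)) (suc K)

S₂-limit : ∀ K → S₂ K K ≈[ K ] D (N φ)
S₂-limit K = begin
  S₂ K K
    ≈⟨ []-⊕ ([]-·ˡ _ (psum-cong[] (H≈[]limit K (const -1ℤ) (⊖X²≈[]0 K)) (suc K))) []-refl ⟩
  const (+ 2) · psum (limit (const -1ℤ)) (suc K) ⊝ const 1ℤ
    ≈⟨ trunc (⊝-cong (·-congˡ _ (≈-trans (psum-cong limit-neg1 (suc K))
         (≈-trans (psum-D (N ∘ T) (suc K)) (D-cong (psum-N T (suc K)))))) ≈-refl) ⟩
  const (+ 2) · D (N (psum T (suc K))) ⊝ const 1ℤ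
    ≈⟨ trunc (≈-trans (D-affine (N (psum T (suc K)))) (D-cong (N-affine (psum T (suc K))))) ⟩
  D (N (φ-partial K))
    ≈⟨ D-cong[] (N-cong[] (φ-partial≈[]φ K)) ⟩
  D (N φ) ∎
  where open Mod K

-- For `σ = s = -1` the factor `-p (p - 1)/(1 - p)` of `H` collapses to `p`.
S₂-initial : ∀ K → S₂ K 0 ≈[ K ] φ
S₂-initial K = []-trans (trunc (⊝-cong (·-congˡ _ (psum-cong (≈-sym ∘ T-H) (suc K))) ≈-refl)) (φ-partial≈[]φ K)
  where
  open Mod K
  T-H : ∀ n → T n ≈ H (const -1ℤ) (⊖ const 1ℤ) n
  T-H = H-unique (const -1ℤ) (⊖ const 1ℤ) T ≈-refl λ n → solve 2 (λ p t →
    (con 1ℤ :- con -1ℤ :* (:- con 1ℤ) :* p) :* (t :* p) := con -1ℤ :* p :* (p :+ :- con 1ℤ) :* t) ≈-refl (oddX n) (T n)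

-- The series v₀

opaque
  unfolding _·_

  q^≈X : ∀ n → q ^ₛ n ≈ X n
  q^≈X zero    = mk≈ λ { zero → refl ; (suc _) → refl }
  q^≈X (suc n) = ·-congˡ q (q^≈X n)

  1ₛ≈1 : 1ₛ ≈ const 1ℤ
  1ₛ≈1 = q^≈X 0

  q²^≈X² : ∀ n → (q ^ₛ 2) ^ₛ n ≈ X² n
  q²^≈X² zero    = 1ₛ≈1
  q²^≈X² (suc n) = ≈-trans (·-cong (q^≈X 2) (q²^≈X² n))
    (≈-trans (solve 2 (λ q e → q :* (q :* con 1ℤ) :* e := e :* (q :* q)) ≈-refl q (X² n)) (≈-sym (X²-suc n)))

  poch-suc : ∀ a n → poch a (q ^ₛ 2) (suc n) ≈ poch a (q ^ₛ 2) n · (const 1ℤ ⊝ a · X² n)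
  poch-suc a n = ·-congˡ (poch a (q ^ₛ 2) n) (⊝-cong 1ₛ≈1 (·-congˡ a (q²^≈X² n)))

  q^square : ∀ n → q ^ₛ (suc n * suc n) ≈ q ^ₛ (n * n) · oddX n
  q^square n = ≈-trans (mk≈ λ i → cong (λ m → (q ^ₛ m) i) square)
    (≈-trans (q^≈X (n * n + suc (n + n))) (≈-trans (X-+ (n * n) (suc (n + n))) (·-congʳ (oddX n) (≈-sym (q^≈X (n * n))))))
    where
    square : suc n * suc n ≡ n * n + suc (n + n)
    square = trans (cong (λ m → suc (n + m)) (ℕ.*-suc n n))
      (trans (cong suc (trans (sym (ℕ.+-assoc n n (n * n))) (ℕ.+-comm (n + n) (n * n)))) (sym (ℕ.+-suc (n * n) (n + n))))

  term-poch : ∀ n → term n · poch q (q ^ₛ 2) n ≈ q ^ₛ (n * n) · poch (-ₛ q) (q ^ₛ 2) n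
  term-poch n = mk≈ (/ₛ-*ₛ (q ^ₛ (n * n) *ₛ poch (-ₛ q) (q ^ₛ 2) n) (poch q (q ^ₛ 2) n) (poch-q-constant (q ^ₛ 2) n))

  ⊖q≡ : -ₛ q ≡ ⊖ q
  ⊖q≡ = refl

term-suc : ∀ n → (const 1ℤ ⊝ oddX n) · term (suc n) ≈ oddX n · (const 1ℤ ⊕ oddX n) · term n
term-suc n = cancel (poch q (q ^ₛ 2) n) (poch-q-constant (q ^ₛ 2) n) (begin
  B · ((const 1ℤ ⊝ p) · term (suc n))
    ≈⟨ solve 3 (λ b c t → b :* (c :* t) := t :* (b :* c)) ≈-refl B (const 1ℤ ⊝ p) (term (suc n)) ⟩
  term (suc n) · (B · (const 1ℤ ⊝ p))
    ≈⟨ ·-congˡ (term (suc n)) (poch-suc q n) ⟨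
  term (suc n) · poch q (q ^ₛ 2) (suc n)
    ≈⟨ term-poch (suc n) ⟩
  q ^ₛ (suc n * suc n) · poch (-ₛ q) (q ^ₛ 2) (suc n)
    ≈⟨ ·-cong (q^square n) (poch-suc (-ₛ q) n) ⟩
  Z · p · (B′ · (const 1ℤ ⊝ -ₛ q · X² n))
    ≈⟨ ·-congˡ (Z · p) (·-congˡ B′ (⊝-cong ≈-refl (·-congʳ (X² n) (mk≈ λ i → cong (λ f → f i) ⊖q≡)))) ⟩
  Z · p · (B′ · (const 1ℤ ⊝ ⊖ q · X² n))
    ≈⟨ solve 4 (λ z b q e → z :* (q :* e) :* (b :* (con 1ℤ :- (:- q) :* e)) := (q :* e) :* (con 1ℤ :+ q :* e) :* (z :* b)) ≈-refl Z B′ q (X² n) ⟩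
  p · (const 1ℤ ⊕ p) · (Z · B′)
    ≈⟨ ·-congˡ (p · (const 1ℤ ⊕ p)) (term-poch n) ⟨
  p · (const 1ℤ ⊕ p) · (term n · B)
    ≈⟨ solve 3 (λ x t b → x :* (t :* b) := b :* (x :* t)) ≈-refl (p · (const 1ℤ ⊕ p)) (term n) B ⟩
  B · (p · (const 1ℤ ⊕ p) · term n) ∎)
  where
  open ≈-Reasoning
  p B B′ Z : PowerSeries
  p = oddX n
  B = poch q (q ^ₛ 2) n
  B′ = poch (-ₛ q) (q ^ₛ 2) n
  Z = q ^ₛ (n * n)

term≈H : ∀ n → term n ≈ H (const 1ℤ) (const 1ℤ) n
term≈H = H-unique (const 1ℤ) (const 1ℤ) term term-zero λ n →
  ≈-trans (·-congʳ _ (⊝-cong ≈-refl (solve 1 (λ p → con 1ℤ :* con 1ℤ :* p := p) ≈-refl (oddX n))))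
  (≈-trans (term-suc n) (·-congʳ _ (solve 1 (λ p → p :* (con 1ℤ :+ p) := con 1ℤ :* p :* (p :+ con 1ℤ)) ≈-refl (oddX n))))
  where
  term-zero : term 0 ≈ const 1ℤ
  term-zero = cancel 1ₛ refl (≈-trans (·-comm 1ₛ (term 0)) (≈-trans (term-poch 0) (·-congˡ 1ₛ 1ₛ≈1)))

v₀≈total : v₀ ≈ total (H (const 1ℤ) (const 1ℤ))
v₀≈total = ≈-trans (mk≈ λ i → v₀-psum term (suc i) i) (total-cong term≈H)
  where
  v₀-psum : ∀ F M i → ∑[ n < M ] F (Fin.toℕ n) i ≡ psum F M i
  v₀-psum F zero    i = zero-at i
    where
    zero-at : ∀ i → 0ℤ ≡ const 0ℤ i
    zero-at zero    = refl
    zero-at (suc _) = refl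
  v₀-psum F (suc M) i = trans (cong (ℤ._+_ (F 0 i)) (v₀-psum (F ∘ suc) M i))
    (sym (trans (coeff (psum-front F M) i) (⊕-at (F 0) (psum (F ∘ suc) M) i)))

-- The series `Σ V(2n) qⁿ`.
W : PowerSeries
W = const (+ 2) · ev v₀ ⊝ const 1ℤ

S₁-initial : ∀ K → S₁ K 0 ≈[ K ] D W
S₁-initial K = begin
  psum (H (const 1ℤ) (const 1ℤ)) (suc K) ⊕ psum (H (const 1ℤ) (⊖ const 1ℤ)) (suc K) ⊝ const 1ℤ
    ≈⟨ []-⊕ ([]-⊕ sum₊ (trunc (psum-cong (≈-sym ∘ N-H) (suc K)))) []-refl ⟩
  v₀ ⊕ psum (N ∘ H (const 1ℤ) (const 1ℤ)) (suc K) ⊝ const 1ℤ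
    ≈⟨ []-⊕ ([]-⊕ []-refl (trunc (psum-N (H (const 1ℤ) (const 1ℤ)) (suc K)))) []-refl ⟩
  v₀ ⊕ N (psum (H (const 1ℤ) (const 1ℤ)) (suc K)) ⊝ const 1ℤ
    ≈⟨ []-⊕ ([]-⊕ []-refl (N-cong[] sum₊)) []-refl ⟩
  v₀ ⊕ N v₀ ⊝ const 1ℤ
    ≈⟨ trunc (⊝-cong (f⊕Nf v₀) ≈-refl) ⟩
  const (+ 2) · D (ev v₀) ⊝ const 1ℤ
    ≈⟨ trunc (D-affine (ev v₀)) ⟩
  D W ∎
  where
  open Mod K
  sum₊ : psum (H (const 1ℤ) (const 1ℤ)) (suc K) ≈[ K ] v₀
  sum₊ = []-trans (psum≈[]total K _ (H-order (const 1ℤ) (const 1ℤ))) (trunc (≈-sym v₀≈total))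
  -- The substitution `q ↦ -q` takes `p (p + 1)/(1 - p)` to `p (p - 1)/(1 + p)`, the factor of `H`
  -- for `s = -1`.
  N-H : ∀ n → N (H (const 1ℤ) (const 1ℤ) n) ≈ H (const 1ℤ) (⊖ const 1ℤ) n
  N-H = H-unique (const 1ℤ) (⊖ const 1ℤ) (N ∘ H (const 1ℤ) (const 1ℤ)) (N-const 1ℤ) λ n →
    let p = oddX n; h = H (const 1ℤ) (const 1ℤ) n; h′ = H (const 1ℤ) (const 1ℤ) (suc n)
        d = denominator (const 1ℤ) (const 1ℤ) n; f = const 1ℤ · p · (p ⊕ const 1ℤ)
        Nd : N d ≈ const 1ℤ ⊝ const 1ℤ · ⊖ const 1ℤ · p
        Nd = ≈-trans (N-cong (⊝-cong ≈-refl (solve 1 (λ p → con 1ℤ :* con 1ℤ :* p := p) ≈-refl p)))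
             (≈-trans (N-⊝ (const 1ℤ) p) (≈-trans (⊝-cong (N-const 1ℤ) (N-oddX n))
             (solve 1 (λ p → con 1ℤ :- (:- p) := con 1ℤ :- con 1ℤ :* (:- con 1ℤ) :* p) ≈-refl p)))
        Nf : N f ≈ const 1ℤ · p · (p ⊕ ⊖ const 1ℤ)
        Nf = ≈-trans (N-cong (solve 1 (λ p → con 1ℤ :* p :* (p :+ con 1ℤ) := p :* (p :+ con 1ℤ)) ≈-refl p))
             (≈-trans (N-· p (p ⊕ const 1ℤ)) (≈-trans (·-cong (N-oddX n) (≈-trans (N-⊕ p (const 1ℤ)) (⊕-cong (N-oddX n) (N-const 1ℤ))))
             (solve 1 (λ p → (:- p) :* ((:- p) :+ con 1ℤ) := con 1ℤ :* p :* (p :+ :- con 1ℤ)) ≈-refl p)))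
    in ≈-trans (·-congʳ (N h′) (≈-sym Nd)) (≈-trans (≈-sym (N-· d h′))
       (≈-trans (N-cong (H-suc (const 1ℤ) (const 1ℤ) n)) (≈-trans (N-· f h) (·-congʳ (N h) Nf))))

-- Theta identities from the products

c : PowerSeries
c = N φ

W-product : ∀ K → P₊ (K + K) · φ ≈[ K ] P₋ (K + K) · W
W-product K = D-injective[] K (begin
  D (P₊ M · φ)       ≈⟨ trunc (D-· (P₊ M) φ) ⟩
  D (P₊ M) · D φ     ≈⟨ []-·ˡ _ (S₁-limit M) ⟨
  D (P₊ M) · S₁ M M  ≈⟨ S₁-product M M ⟩
  D (P₋ M) · S₁ M 0  ≈⟨ []-·ˡ _ (S₁-initial M) ⟩
  D (P₋ M) · D W     ≈⟨ trunc (D-· (P₋ M) W) ⟨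
  D (P₋ M · W)       ∎)
  where
  M : ℕ
  M = K + K
  open Mod M

φ-product : ∀ M → P₊ M · D c ≈[ M ] P₋ M · φ
φ-product M = []-cancel M (P₋ M) (Monic-P₋ M) (begin
  P₋ M · (P₊ M · D c)   ≈⟨ trunc (assoc (P₋ M) (P₊ M) (D c)) ⟩
  P₋ M · P₊ M · D c     ≈⟨ []-·ˡ _ (S₂-limit M) ⟨
  P₋ M · P₊ M · S₂ M M  ≈⟨ S₂-product M M ⟩
  P₋ M · P₋ M · S₂ M 0  ≈⟨ []-·ˡ _ (S₂-initial M) ⟩
  P₋ M · P₋ M · φ       ≈⟨ trunc (assoc (P₋ M) (P₋ M) φ) ⟨
  P₋ M · (P₋ M · φ)     ∎)
  where
  open Mod M
  assoc : ∀ x y z → x · (y · z) ≈ x · y · z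
  assoc = solve 3 (λ x y z → x :* (y :* z) := x :* y :* z) ≈-refl

-- In the limit `W = φ P₊/P₋` by `W-product`, and `D c · P₊/P₋ = φ` by `φ-product`; the infinite
-- product is eliminated between them.
W·Dc≈φφ : W · D c ≈ φ · φ
W·Dc≈φφ = ≈-from-mod λ K → let open Mod K; P₊ᴹ = P₊ (K + K); P₋ᴹ = P₋ (K + K) in
  []-cancel K P₋ᴹ (Monic-P₋ (K + K)) (begin
    P₋ᴹ · (W · D c)  ≈⟨ trunc (solve 3 (λ p w d → p :* (w :* d) := p :* w :* d) ≈-refl P₋ᴹ W (D c)) ⟩
    P₋ᴹ · W · D c    ≈⟨ []-·ʳ (D c) (W-product K) ⟨
    P₊ᴹ · φ · D c    ≈⟨ trunc (solve 3 (λ p w d → p :* w :* d := w :* (p :* d)) ≈-refl P₊ᴹ φ (D c)) ⟩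
    φ · (P₊ᴹ · D c)  ≈⟨ []-·ˡ φ (weaken (ℕ.m≤m+n K K) (φ-product (K + K))) ⟩
    φ · (P₋ᴹ · φ)    ≈⟨ trunc (solve 2 (λ p w → w :* (p :* w) := p :* (w :* w)) ≈-refl P₋ᴹ φ) ⟩
    P₋ᴹ · (φ · φ)    ∎)

-- `q ↦ -q` fixes `D c` and exchanges `P₊` with `P₋`, so the products cancel when `φ-product` is
-- multiplied by its conjugate.
φ·c≈Dc·Dc : φ · c ≈ D c · D c
φ·c≈Dc·Dc = ≈-from-mod λ K → let open Mod K in
  []-cancel K (P₋ K · P₊ K) (Monic-· (P₋ K) (P₊ K) (Monic-P₋ K) (Monic-P₊ K)) (begin
    P₋ K · P₊ K · (φ · c)       ≈⟨ trunc (solve 4 (λ a b x y → a :* b :* (x :* y) := a :* x :* (b :* y)) ≈-refl (P₋ K) (P₊ K) φ c) ⟩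
    P₋ K · φ · (P₊ K · c)       ≈⟨ []-· (φ-product K) (conjugate K) ⟨
    P₊ K · D c · (P₋ K · D c)   ≈⟨ trunc (solve 3 (λ a b x → b :* x :* (a :* x) := a :* b :* (x :* x)) ≈-refl (P₋ K) (P₊ K) (D c)) ⟩
    P₋ K · P₊ K · (D c · D c)   ∎)
  where
  conjugate : ∀ K → P₋ K · D c ≈[ K ] P₊ K · c
  conjugate K = begin
    P₋ K · D c         ≈⟨ trunc (·-cong (N-P₊ K) (N-D c)) ⟨
    N (P₊ K) · N (D c) ≈⟨ trunc (N-· (P₊ K) (D c)) ⟨
    N (P₊ K · D c)     ≈⟨ N-cong[] (φ-product K) ⟩
    N (P₋ K · φ)       ≈⟨ trunc (N-· (P₋ K) φ) ⟩
    N (P₋ K) · c       ≈⟨ trunc (·-congʳ c (≈-trans (N-cong (≈-sym (N-P₊ K))) (N-involutive (P₊ K)))) ⟩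
    P₊ K · c           ∎
    where open Mod K

-- Coefficients of theta series

T≈X : ∀ k → T k ≈ X (k * k)
T≈X k = ≈-trans (T≈q^ k) (q^≈X (k * k))
  where
  T≈q^ : ∀ k → T k ≈ q ^ₛ (k * k)
  T≈q^ zero    = ≈-sym 1ₛ≈1
  T≈q^ (suc k) = ≈-trans (·-congʳ (oddX k) (T≈q^ k)) (≈-sym (q^square k))

square-injective : ∀ j k → j * j ≡ k * k → j ≡ k
square-injective j k eq with ℕ.<-cmp j k
... | tri< j<k _ _ = ⊥-elim (ℕ.<⇒≢ (ℕ.*-mono-< j<k j<k) eq)
... | tri≈ _ j≡k _ = j≡k
... | tri> _ _ k<j = ⊥-elim (ℕ.>⇒≢ (ℕ.*-mono-< k<j k<j) eq)

psum-T-zero : ∀ M n → (∀ {k} → k < M → k * k ≢ n) → psum T M n ≡ 0ℤ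
psum-T-zero zero    zero    _ = refl
psum-T-zero zero    (suc _) _ = refl
psum-T-zero (suc M) n       p = trans (⊕-at (psum T M) (T M) n)
  (cong₂ ℤ._+_ (psum-T-zero M n (p ∘ ℕ.m≤n⇒m≤1+n))
    (trans (coeff (T≈X M) n) (X-off-diagonal (M * M) n (p ℕ.≤-refl))))

psum-T-one : ∀ M k → k < M → psum T M (k * k) ≡ 1ℤ
psum-T-one (suc M) k (s≤s k≤M) = trans (⊕-at (psum T M) (T M) (k * k)) (split (ℕ.m≤n⇒m<n∨m≡n k≤M))
  where
  split : k < M ⊎ k ≡ M → psum T M (k * k) ℤ.+ T M (k * k) ≡ 1ℤ
  split (inj₁ k<M) = cong₂ ℤ._+_ (psum-T-one M k k<M)
    (trans (coeff (T≈X M) (k * k)) (X-off-diagonal (M * M) (k * k) λ eq → ℕ.<⇒≢ k<M (sym (square-injective M k eq))))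
  split (inj₂ refl) = cong₂ ℤ._+_ (psum-T-zero M (k * k) (λ j<k eq → ℕ.<⇒≢ j<k (square-injective _ k eq)))
    (trans (coeff (T≈X k) (k * k)) (X-diagonal (k * k)))

k≤k*k : ∀ k → k ≤ k * k
k≤k*k zero    = z≤n
k≤k*k (suc k) = ℕ.m≤m+n (suc k) (k * suc k)

-- Natural roots instead of the integer roots of `IsSquare`, so that the search in `square?` is
-- bounded.
Square : ℕ → Set
Square n = ∃[ k ] n ≡ k * k

IsSquare⇒Square : ∀ {n} → IsSquare n → Square n
IsSquare⇒Square (k , eq) = ℤ.∣ k ∣ , trans (cong ℤ.∣_∣ eq) (ℤ.abs-* k k)

Square⇒IsSquare : ∀ {n} → Square n → IsSquare n
Square⇒IsSquare (k , eq) = + k , trans (cong (λ m → + m) eq) (ℤ.pos-* k k)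

Θ-square : ∀ {n} → Square n → Θ n ≡ 1ℤ
Θ-square (k , refl) = psum-T-one (suc (k * k)) k (s≤s (k≤k*k k))

Θ-nonsquare : ∀ {n} → ¬ Square n → Θ n ≡ 0ℤ
Θ-nonsquare {n} ¬sq = psum-T-zero (suc n) n λ {k} _ eq → ¬sq (k , sym eq)

square? : ∀ n → Dec (Square n)
square? n with ℕ.anyUpTo? (λ k → n ℕ.≟ k * k) (suc n)
... | yes (k , _ , eq) = yes (k , eq)
... | no ¬p            = no λ (k , eq) → ¬p (k , s≤s (ℕ.≤-trans (k≤k*k k) (ℕ.≤-reflexive (sym eq))) , eq)

double : ℕ → ℕ
double n = n + n

2*≡double : ∀ n → 2 * n ≡ double n
2*≡double n = cong (_+_ n) (ℕ.+-identityʳ n)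

double-injective : ∀ {m n} → double m ≡ double n → m ≡ n
double-injective {m} {n} eq = ℕ.*-cancelˡ-≡ m n 2 (trans (2*≡double m) (trans eq (sym (2*≡double n))))

double≢suc-double : ∀ m n → double m ≢ suc (double n)
double≢suc-double m n eq = ℕ.even≢odd m n (trans (2*≡double m) (trans eq (cong suc (sym (2*≡double n)))))

double-+ : ∀ m n → double (m + n) ≡ double m + double n
double-+ m n = trans (sym (2*≡double (m + n))) (trans (ℕ.*-distribˡ-+ 2 m n) (cong₂ _+_ (2*≡double m) (2*≡double n)))

double-* : ∀ j → double j * double j ≡ double (double (j * j))
double-* j = trans (ℕ.*-distribʳ-+ (double j) j j) (cong double (ℕ.*-distribˡ-+ j j j))

suc-double-* : ∀ j → suc (double j) * suc (double j) ≡ suc (double (double (j * j + j)))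
suc-double-* j = cong suc (begin
  d + d * suc d                           ≡⟨ cong (_+_ d) (ℕ.*-suc d d) ⟩
  d + (d + d * d)                         ≡⟨ ℕ.+-assoc d d (d * d) ⟨
  double d + d * d                        ≡⟨ ℕ.+-comm (double d) (d * d) ⟩
  d * d + double d                        ≡⟨ cong (_+ double d) (double-* j) ⟩
  double (double (j * j)) + double d      ≡⟨ double-+ (double (j * j)) d ⟨
  double (double (j * j) + double j)      ≡⟨ cong double (double-+ (j * j) j) ⟨
  double (double (j * j + j))             ∎)
  where
  open ≡-Reasoning
  d : ℕ
  d = double j

square-mod4 : ∀ {m} → Square m →
  (∃[ j ] m ≡ double (double (j * j))) ⊎ (∃[ j ] m ≡ suc (double (double (j * j + j))))
square-mod4 (k , refl) with even-or-odd k
... | j , inj₁ refl = inj₁ (j , double-* j)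
... | j , inj₂ refl = inj₂ (j , suc-double-* j)

Θ-4n : ∀ n → Θ (double (double n)) ≡ Θ n
Θ-4n n with square? n
... | yes (k , refl) = trans (Θ-square {double (double (k * k))} (k + k , sym (double-* k))) (sym (Θ-square {k * k} (k , refl)))
... | no ¬sq = trans (Θ-nonsquare (λ sq → case (square-mod4 sq))) (sym (Θ-nonsquare ¬sq))
  where
  case : _ → ⊥
  case (inj₁ (j , eq)) = ¬sq (j , double-injective (double-injective {double n} eq))
  case (inj₂ (j , eq)) = double≢suc-double (double n) (double (j * j + j)) eq

Θ-4n+2 : ∀ n → Θ (double (suc (double n))) ≡ 0ℤ
Θ-4n+2 n = Θ-nonsquare (λ sq → case (square-mod4 sq))
  where
  case : _ → ⊥
  case (inj₁ (j , eq)) = double≢suc-double (j * j) n (sym (double-injective {suc (double n)} eq))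
  case (inj₂ (j , eq)) = double≢suc-double (suc (double n)) (double (j * j + j)) eq

Θ-4n+3 : ∀ n → Θ (suc (double (suc (double n)))) ≡ 0ℤ
Θ-4n+3 n = Θ-nonsquare (λ sq → case (square-mod4 sq))
  where
  case : _ → ⊥
  case (inj₁ (j , eq)) = double≢suc-double (double (j * j)) (suc (double n)) (sym eq)
  case (inj₂ (j , eq)) = double≢suc-double (j * j + j) n (sym (double-injective {suc (double n)} (ℕ.suc-injective eq)))

-- Since `(2j + 1)² = 4(j² + j) + 1`, `β′` is `Σ_{j≥0} q^{j(j+1)}`, classically `ψ(q²)`.
β′ β : PowerSeries
β′ = ev (od Θ)
β  = const (+ 2) · β′

ev-Θ : ev Θ ≈ D Θ
ev-Θ = even-odd-ext (mk≈ λ n → trans (Θ-4n n) (sym (coeff (ev-D Θ) n)))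
                    (mk≈ λ n → trans (Θ-4n+2 n) (sym (od-D Θ n)))

od-Θ : od Θ ≈ D β′
od-Θ = even-odd-ext (≈-sym (ev-D β′)) (mk≈ λ n → trans (Θ-4n+3 n) (sym (od-D β′ n)))

Θ-dissection : Θ ≈ D (D Θ) ⊕ q · D (D β′)
Θ-dissection = ≈-trans (dissect Θ) (⊕-cong (D-cong ev-Θ) (·-congˡ q (D-cong od-Θ)))

-- Jacobi's quartic identity

φ-dissection : φ ≈ D (D φ) ⊕ q · D (D β)
φ-dissection = begin
  const (+ 2) · Θ ⊝ const 1ℤ
    ≈⟨ ⊝-cong (·-congˡ _ Θ-dissection) ≈-refl ⟩
  const (+ 2) · (D (D Θ) ⊕ q · D (D β′)) ⊝ const 1ℤ
    ≈⟨ solve 3 (λ x q y → con (+ 2) :* (x :+ q :* y) :- con 1ℤ := (con (+ 2) :* x :- con 1ℤ) :+ q :* (con (+ 2) :* y))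
         ≈-refl (D (D Θ)) q (D (D β′)) ⟩
  (const (+ 2) · D (D Θ) ⊝ const 1ℤ) ⊕ q · (const (+ 2) · D (D β′))
    ≈⟨ ⊕-cong (≈-trans (D-affine (D Θ)) (D-cong (D-affine Θ))) (·-congˡ q (≈-sym (D-2 (D-2 ≈-refl)))) ⟩
  D (D φ) ⊕ q · D (D β) ∎
  where
  open ≈-Reasoning
  D-2 : ∀ {f g} → f ≈ const (+ 2) · g → D f ≈ const (+ 2) · D g
  D-2 {f} {g} p = ≈-trans (D-cong p) (≈-trans (D-· (const (+ 2)) g) (·-congʳ (D g) (D-const (+ 2))))

c-dissection : c ≈ D (D φ) ⊝ q · D (D β)
c-dissection = begin
  N φ                            ≈⟨ N-cong φ-dissection ⟩
  N (D (D φ) ⊕ q · D (D β))      ≈⟨ N-⊕ (D (D φ)) (q · D (D β)) ⟩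
  N (D (D φ)) ⊕ N (q · D (D β))  ≈⟨ ⊕-cong (N-D (D φ)) (≈-trans (N-· q (D (D β))) (·-cong N-q (N-D (D β)))) ⟩
  D (D φ) ⊕ ⊖ q · D (D β)        ≈⟨ solve 3 (λ x q y → x :+ (:- q) :* y := x :- q :* y) ≈-refl (D (D φ)) q (D (D β)) ⟩
  D (D φ) ⊝ q · D (D β)          ∎
  where open ≈-Reasoning

-- `D (c · c) = φ · c` is a difference of two squares by the dissections of `φ` and `c`; it is a
-- series in `q²`, and `D` can be stripped.
cc-dissection : c · c ≈ D φ · D φ ⊝ q · (D β · D β)
cc-dissection = D-injective (begin
  D (c · c)
    ≈⟨ D-· c c ⟩
  D c · D c
    ≈⟨ φ·c≈Dc·Dc ⟨
  φ · c
    ≈⟨ ·-cong φ-dissection c-dissection ⟩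
  (D (D φ) ⊕ q · D (D β)) · (D (D φ) ⊝ q · D (D β))
    ≈⟨ solve 3 (λ x q y → (x :+ q :* y) :* (x :- q :* y) := x :* x :- q :* q :* (y :* y)) ≈-refl (D (D φ)) q (D (D β)) ⟩
  D (D φ) · D (D φ) ⊝ q · q · (D (D β) · D (D β))
    ≈⟨ ⊝-cong (D-· (D φ) (D φ)) (·-cong D-q (D-· (D β) (D β))) ⟨
  D (D φ · D φ) ⊝ D q · D (D β · D β)
    ≈⟨ ⊝-cong ≈-refl (D-· q (D β · D β)) ⟨
  D (D φ · D φ) ⊝ D (q · (D β · D β))
    ≈⟨ D-⊝ (D φ · D φ) (q · (D β · D β)) ⟨
  D (D φ · D φ ⊝ q · (D β · D β)) ∎)
  where open ≈-Reasoning

φφ-dissection : φ · φ ≈ D φ · D φ ⊕ q · (D β · D β)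
φφ-dissection = begin
  φ · φ
    ≈⟨ ·-cong (N-involutive φ) (N-involutive φ) ⟨
  N c · N c
    ≈⟨ N-· c c ⟨
  N (c · c)
    ≈⟨ N-cong cc-dissection ⟩
  N (D φ · D φ ⊝ q · (D β · D β))
    ≈⟨ N-⊝ (D φ · D φ) (q · (D β · D β)) ⟩
  N (D φ · D φ) ⊝ N (q · (D β · D β))
    ≈⟨ ⊝-cong (N-D² φ) (≈-trans (N-· q (D β · D β)) (·-cong N-q (N-D² β))) ⟩
  D φ · D φ ⊝ ⊖ q · (D β · D β)
    ≈⟨ solve 3 (λ x q y → x :- (:- q) :* y := x :+ q :* y) ≈-refl (D φ · D φ) q (D β · D β) ⟩
  D φ · D φ ⊕ q · (D β · D β) ∎
  where
  open ≈-Reasoning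
  N-D² : ∀ f → N (D f · D f) ≈ D f · D f
  N-D² f = ≈-trans (N-· (D f) (D f)) (·-cong (N-D f) (N-D f))

φφ-D : φ · φ ≈ D (φ · φ) ⊕ q · D (β · β)
φφ-D = ≈-trans φφ-dissection (⊕-cong (≈-sym (D-· φ φ)) (·-congˡ q (≈-sym (D-· β β))))

-- Two computations of the odd part of `φ²`: from `φφ-D`, and by squaring the dissection of `φ`.
-- Classically this is `ψ(q)² = φ(q) ψ(q²)` with `q²` for `q`.
ββ≈2Dφβ : β · β ≈ const (+ 2) · (D φ · D β)
ββ≈2Dφβ = begin
  β · β
    ≈⟨ od-Dq (φ · φ) (β · β) ⟨
  od (D (φ · φ) ⊕ q · D (β · β))
    ≈⟨ od-cong φφ-D ⟨
  od (φ · φ)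
    ≈⟨ od-cong square ⟩
  od (D (D φ · D φ ⊕ q · (D β · D β)) ⊕ q · D (const (+ 2) · (D φ · D β)))
    ≈⟨ od-Dq (D φ · D φ ⊕ q · (D β · D β)) (const (+ 2) · (D φ · D β)) ⟩
  const (+ 2) · (D φ · D β) ∎
  where
  open ≈-Reasoning
  square : φ · φ ≈ D (D φ · D φ ⊕ q · (D β · D β)) ⊕ q · D (const (+ 2) · (D φ · D β))
  square = begin
    φ · φ
      ≈⟨ ·-cong φ-dissection φ-dissection ⟩
    (D (D φ) ⊕ q · D (D β)) · (D (D φ) ⊕ q · D (D β))
      ≈⟨ solve 3 (λ x q y → (x :+ q :* y) :* (x :+ q :* y) := x :* x :+ q :* q :* (y :* y) :+ q :* (con (+ 2) :* (x :* y)))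
           ≈-refl (D (D φ)) q (D (D β)) ⟩
    D (D φ) · D (D φ) ⊕ q · q · (D (D β) · D (D β)) ⊕ q · (const (+ 2) · (D (D φ) · D (D β)))
      ≈⟨ ⊕-cong (⊕-cong (D-· (D φ) (D φ)) (·-cong D-q (D-· (D β) (D β))))
                (·-congˡ q (·-cong (D-const (+ 2)) (D-· (D φ) (D β)))) ⟨
    D (D φ · D φ) ⊕ D q · D (D β · D β) ⊕ q · (D (const (+ 2)) · D (D φ · D β))
      ≈⟨ ⊕-cong (⊕-cong ≈-refl (D-· q (D β · D β))) (·-congˡ q (D-· (const (+ 2)) (D φ · D β))) ⟨
    D (D φ · D φ) ⊕ D (q · (D β · D β)) ⊕ q · D (const (+ 2) · (D φ · D β))
      ≈⟨ ⊕-cong (D-⊕ (D φ · D φ) (q · (D β · D β))) ≈-refl ⟨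
    D (D φ · D φ ⊕ q · (D β · D β)) ⊕ q · D (const (+ 2) · (D φ · D β)) ∎

quad : PowerSeries → PowerSeries
quad f = (f · f) · (f · f)

quad-cong : ∀ {f g} → f ≈ g → quad f ≈ quad g
quad-cong p = ·-cong (·-cong p p) (·-cong p p)

quad-· : ∀ f g → quad (f · g) ≈ quad f · quad g
quad-· = solve 2 (λ f g → ((f :* g) :* (f :* g)) :* ((f :* g) :* (f :* g))
                       := ((f :* f) :* (f :* f)) :* ((g :* g) :* (g :* g))) ≈-refl

-- With `x = D φ` and `y = D β`, `(x² + q y²)² - (x² - q y²)² = q (2xy)²`, and `2xy = β²`.
-- Classically `φ(q)⁴ - φ(-q)⁴ = 16 q ψ(q²)⁴`.
jacobi : quad φ ⊝ quad c ≈ q · quad β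
jacobi = begin
  (φ · φ) · (φ · φ) ⊝ (c · c) · (c · c)
    ≈⟨ ⊝-cong (·-cong φφ-dissection φφ-dissection) (·-cong cc-dissection cc-dissection) ⟩
  (D φ · D φ ⊕ q · (D β · D β)) · (D φ · D φ ⊕ q · (D β · D β)) ⊝ (D φ · D φ ⊝ q · (D β · D β)) · (D φ · D φ ⊝ q · (D β · D β))
    ≈⟨ solve 3 (λ x q y → (x :* x :+ q :* (y :* y)) :* (x :* x :+ q :* (y :* y)) :- (x :* x :- q :* (y :* y)) :* (x :* x :- q :* (y :* y))
          := q :* ((con (+ 2) :* (x :* y)) :* (con (+ 2) :* (x :* y)))) ≈-refl (D φ) q (D β) ⟩
  q · ((const (+ 2) · (D φ · D β)) · (const (+ 2) · (D φ · D β)))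
    ≈⟨ ·-congˡ q (·-cong ββ≈2Dφβ ββ≈2Dφβ) ⟨
  q · quad β ∎
  where open ≈-Reasoning

-- The projection formula: taking even parts is linear over the series in `q²`.
ev-D· : ∀ f g → ev (D f · g) ≈ f · ev g
ev-D· f g = begin
  ev (D f · g)
    ≈⟨ ev-cong (·-congˡ (D f) (dissect g)) ⟩
  ev (D f · (D (ev g) ⊕ q · D (od g)))
    ≈⟨ ev-cong (solve 4 (λ f x q y → f :* (x :+ q :* y) := f :* x :+ q :* (f :* y)) ≈-refl (D f) (D (ev g)) q (D (od g))) ⟩
  ev (D f · D (ev g) ⊕ q · (D f · D (od g)))
    ≈⟨ ev-cong (⊕-cong (D-· f (ev g)) (·-congˡ q (D-· f (od g)))) ⟨
  ev (D (f · ev g) ⊕ q · D (f · od g))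
    ≈⟨ ev-Dq (f · ev g) (f · od g) ⟩
  f · ev g ∎
  where open ≈-Reasoning

G : PowerSeries
G = ev W

-- The even part of `W · D c = φ²`: `φφ-D` makes `φ²` its own even part, that is, `2n` and `n` are
-- sums of two squares in equally many ways.
c·G : c · G ≈ φ · φ
c·G = begin
  c · ev W                         ≈⟨ ev-D· c W ⟨
  ev (D c · W)                     ≈⟨ ev-cong (≈-trans (·-comm (D c) W) W·Dc≈φφ) ⟩
  ev (φ · φ)                       ≈⟨ ev-cong φφ-D ⟩
  ev (D (φ · φ) ⊕ q · D (β · β))   ≈⟨ ev-Dq (φ · φ) (β · β) ⟩
  φ · φ                            ∎
  where open ≈-Reasoning

-- The operator U = U₄

D⁴ : PowerSeries → PowerSeries
D⁴ f = D (D f)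

U : PowerSeries → PowerSeries
U f = ev (ev f)

D⁴-cong : ∀ {f g} → f ≈ g → D⁴ f ≈ D⁴ g
D⁴-cong p = D-cong (D-cong p)

D⁴-· : ∀ f g → D⁴ (f · g) ≈ D⁴ f · D⁴ g
D⁴-· f g = ≈-trans (D-cong (D-· f g)) (D-· (D f) (D g))

D⁴-⊕ : ∀ f g → D⁴ (f ⊕ g) ≈ D⁴ f ⊕ D⁴ g
D⁴-⊕ f g = ≈-trans (D-cong (D-⊕ f g)) (D-⊕ (D f) (D g))

D⁴-⊖ : ∀ f → D⁴ (⊖ f) ≈ ⊖ D⁴ f
D⁴-⊖ f = ≈-trans (D-cong (D-⊖ f)) (D-⊖ (D f))

D⁴-⊝ : ∀ f g → D⁴ (f ⊝ g) ≈ D⁴ f ⊝ D⁴ g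
D⁴-⊝ f g = ≈-trans (D⁴-⊕ f (⊖ g)) (⊕-cong ≈-refl (D⁴-⊖ g))

D⁴-const : ∀ k → D⁴ (const k) ≈ const k
D⁴-const k = ≈-trans (D-cong (D-const k)) (D-const k)

D⁴-quad : ∀ f → D⁴ (quad f) ≈ quad (D⁴ f)
D⁴-quad f = ≈-trans (D⁴-· (f · f) (f · f)) (·-cong (D⁴-· f f) (D⁴-· f f))

D⁴-q : D⁴ q ≈ quad q
D⁴-q = ≈-trans (D-cong D-q) (≈-trans (D-· q q) (·-cong D-q D-q))

U-cong : ∀ {f g} → f ≈ g → U f ≈ U g
U-cong p = ev-cong (ev-cong p)

U-⊕ : ∀ f g → U (f ⊕ g) ≈ U f ⊕ U g
U-⊕ f g = ≈-trans (ev-cong (ev-⊕ f g)) (ev-⊕ (ev f) (ev g))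

U-⊖ : ∀ f → U (⊖ f) ≈ ⊖ U f
U-⊖ f = ≈-trans (ev-cong (ev-⊖ f)) (ev-⊖ (ev f))

U-const : ∀ k → U (const k) ≈ const k
U-const k = ≈-trans (ev-cong (ev-const k)) (ev-const k)

U-scale : ∀ k f → U (const k · f) ≈ const k · U f
U-scale k f = mk≈ λ n → trans (const-·-at k f _) (sym (const-·-at k (U f) n))

U-4-dissection : ∀ x₀ x₁ x₂ x₃ → U (D⁴ x₀ ⊕ q · D⁴ x₁ ⊕ q · q · D⁴ x₂ ⊕ q · q · q · D⁴ x₃) ≈ x₀
U-4-dissection x₀ x₁ x₂ x₃ = ≈-trans (ev-cong (≈-trans (ev-cong regroup) (ev-Dq (D x₀ ⊕ q · D x₂) (D x₁ ⊕ q · D x₃)))) (ev-Dq x₀ x₂)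
  where
  open ≈-Reasoning
  D-pair : ∀ x y → D (D x ⊕ q · D y) ≈ D⁴ x ⊕ q · q · D⁴ y
  D-pair x y = ≈-trans (D-⊕ (D x) (q · D y)) (⊕-cong ≈-refl (≈-trans (D-· q (D y)) (·-congʳ (D⁴ y) D-q)))
  regroup : D⁴ x₀ ⊕ q · D⁴ x₁ ⊕ q · q · D⁴ x₂ ⊕ q · q · q · D⁴ x₃ ≈ D (D x₀ ⊕ q · D x₂) ⊕ q · D (D x₁ ⊕ q · D x₃)
  regroup = begin
    D⁴ x₀ ⊕ q · D⁴ x₁ ⊕ q · q · D⁴ x₂ ⊕ q · q · q · D⁴ x₃
      ≈⟨ solve 5 (λ q a b c d → a :+ q :* b :+ q :* q :* c :+ q :* q :* q :* d := (a :+ q :* q :* c) :+ q :* (b :+ q :* q :* d))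
           ≈-refl q (D⁴ x₀) (D⁴ x₁) (D⁴ x₂) (D⁴ x₃) ⟩
    (D⁴ x₀ ⊕ q · q · D⁴ x₂) ⊕ q · (D⁴ x₁ ⊕ q · q · D⁴ x₃)
      ≈⟨ ⊕-cong (D-pair x₀ x₂) (·-congˡ q (D-pair x₁ x₃)) ⟨
    D (D x₀ ⊕ q · D x₂) ⊕ q · D (D x₁ ⊕ q · D x₃) ∎

-- The modular functions u, t, z

opaque
  unfolding _·_

  Monic-φ : Monic φ
  Monic-φ = refl

Monic-c : Monic c
Monic-c = Monic-φ

φ⁻¹ c⁻¹ : PowerSeries
φ⁻¹ = inv φ
c⁻¹ = inv c

-- `φ = a + b` is the dissection modulo 4 and `u = b/a`. Writing `u` as `q ν(q⁴)` shows that `uⁱ`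
-- has only exponents congruent to `i` modulo 4.
a b ν u : PowerSeries
a = D⁴ φ
b = q · D⁴ β
ν = β · φ⁻¹
u = q · D⁴ ν

-- `w = z/t` is the series with `w(q⁴) = u⁴`; it is what `U` leaves of a factor `u⁴`.
t t⁻¹ z w τ : PowerSeries
t   = quad (φ · c⁻¹)
t⁻¹ = quad (c · φ⁻¹)
z   = t ⊝ const 1ℤ
w   = const 1ℤ ⊝ t⁻¹
τ   = D⁴ t

quad-1 : ∀ {f} → f ≈ const 1ℤ → quad f ≈ const 1ℤ
quad-1 p = ≈-trans (quad-cong p) (solve 0 ((con 1ℤ :* con 1ℤ) :* (con 1ℤ :* con 1ℤ) := con 1ℤ) ≈-refl)

t·t⁻¹ : t · t⁻¹ ≈ const 1ℤ
t·t⁻¹ = ≈-trans (≈-sym (quad-· (φ · c⁻¹) (c · φ⁻¹))) (quad-1 (begin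
  φ · c⁻¹ · (c · φ⁻¹)      ≈⟨ solve 4 (λ a b c d → a :* b :* (c :* d) := d :* a :* (b :* c)) ≈-refl φ c⁻¹ c φ⁻¹ ⟩
  φ⁻¹ · φ · (c⁻¹ · c)      ≈⟨ ·-cong (inv-inverse φ Monic-φ) (inv-inverse c Monic-c) ⟩
  const 1ℤ · const 1ℤ      ≈⟨ solve 0 (con 1ℤ :* con 1ℤ := con 1ℤ) ≈-refl ⟩
  const 1ℤ                 ∎))
  where open ≈-Reasoning

t·w : t · w ≈ z
t·w = ≈-trans (solve 2 (λ t i → t :* (con 1ℤ :- i) := t :- t :* i) ≈-refl t t⁻¹) (⊝-cong ≈-refl t·t⁻¹)

t⁻¹·z : t⁻¹ · z ≈ w
t⁻¹·z = ≈-trans (solve 2 (λ t i → i :* (t :- con 1ℤ) := t :* i :- i) ≈-refl t t⁻¹) (⊝-cong t·t⁻¹ ≈-refl)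

t·c⁴ : t · quad c ≈ quad φ
t·c⁴ = ≈-trans (≈-sym (quad-· (φ · c⁻¹) c)) (quad-cong
  (≈-trans (solve 3 (λ x y z → x :* y :* z := y :* z :* x) ≈-refl φ c⁻¹ c)
  (≈-trans (·-congʳ φ (inv-inverse c Monic-c)) (solve 1 (λ x → con 1ℤ :* x := x) ≈-refl φ))))

a·u : a · u ≈ b
a·u = begin
  D⁴ φ · (q · D⁴ (β · φ⁻¹))  ≈⟨ solve 3 (λ x q y → x :* (q :* y) := q :* (y :* x)) ≈-refl (D⁴ φ) q (D⁴ (β · φ⁻¹)) ⟩
  q · (D⁴ (β · φ⁻¹) · D⁴ φ)  ≈⟨ ·-congˡ q (D⁴-· (β · φ⁻¹) φ) ⟨
  q · D⁴ (β · φ⁻¹ · φ)       ≈⟨ ·-congˡ q (D⁴-cong (≈-trans (solve 3 (λ x y z → x :* y :* z := y :* z :* x) ≈-refl β φ⁻¹ φ)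
                                  (≈-trans (·-congʳ β (inv-inverse φ Monic-φ)) (solve 1 (λ x → con 1ℤ :* x := x) ≈-refl β)))) ⟩
  q · D⁴ β                   ∎
  where open ≈-Reasoning

φ≈a[1+u] : φ ≈ a · (const 1ℤ ⊕ u)
φ≈a[1+u] = ≈-trans φ-dissection (≈-sym (≈-trans
  (solve 2 (λ a u → a :* (con 1ℤ :+ u) := a :+ a :* u) ≈-refl a u) (⊕-cong ≈-refl a·u)))

c≈a[1-u] : c ≈ a · (const 1ℤ ⊝ u)
c≈a[1-u] = ≈-trans c-dissection (≈-sym (≈-trans
  (solve 2 (λ a u → a :* (con 1ℤ :- u) := a :- a :* u) ≈-refl a u) (⊝-cong ≈-refl a·u)))

-- Jacobi's identity divided by `φ⁴`, taken at `q⁴`.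
u⁴ : quad u ≈ D⁴ w
u⁴ = begin
  quad (q · D⁴ ν)
    ≈⟨ quad-· q (D⁴ ν) ⟩
  quad q · quad (D⁴ ν)
    ≈⟨ ·-cong D⁴-q (D⁴-quad ν) ⟨
  D⁴ q · D⁴ (quad ν)
    ≈⟨ D⁴-· q (quad ν) ⟨
  D⁴ (q · quad ν)
    ≈⟨ D⁴-cong (begin
         q · quad (β · φ⁻¹)                   ≈⟨ ·-congˡ q (quad-· β φ⁻¹) ⟩
         q · (quad β · quad φ⁻¹)              ≈⟨ solve 3 (λ q x y → q :* (x :* y) := q :* x :* y) ≈-refl q (quad β) (quad φ⁻¹) ⟩
         q · quad β · quad φ⁻¹                ≈⟨ ·-congʳ (quad φ⁻¹) jacobi ⟨
         (quad φ ⊝ quad c) · quad φ⁻¹         ≈⟨ solve 3 (λ x y z → (x :- y) :* z := z :* x :- y :* z) ≈-refl (quad φ) (quad c) (quad φ⁻¹) ⟩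
         quad φ⁻¹ · quad φ ⊝ quad c · quad φ⁻¹ ≈⟨ ⊝-cong (≈-sym (quad-· φ⁻¹ φ)) (≈-sym (quad-· c φ⁻¹)) ⟩
         quad (φ⁻¹ · φ) ⊝ t⁻¹                 ≈⟨ ⊝-cong (quad-1 (inv-inverse φ Monic-φ)) ≈-refl ⟩
         const 1ℤ ⊝ t⁻¹                       ∎) ⟩
  D⁴ w ∎
  where open ≈-Reasoning

τ[1-u⁴] : τ · (const 1ℤ ⊝ quad u) ≈ const 1ℤ
τ[1-u⁴] = begin
  τ · (const 1ℤ ⊝ quad u)        ≈⟨ ·-congˡ τ (⊝-cong (≈-sym (D⁴-const 1ℤ)) u⁴) ⟩
  τ · (D⁴ (const 1ℤ) ⊝ D⁴ w)     ≈⟨ ·-congˡ τ (D⁴-⊝ (const 1ℤ) w) ⟨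
  D⁴ t · D⁴ (const 1ℤ ⊝ w)       ≈⟨ D⁴-· t (const 1ℤ ⊝ w) ⟨
  D⁴ (t · (const 1ℤ ⊝ w))        ≈⟨ D⁴-cong (≈-trans (·-congˡ t (solve 1 (λ i → con 1ℤ :- (con 1ℤ :- i) := i) ≈-refl t⁻¹)) t·t⁻¹) ⟩
  D⁴ (const 1ℤ)                  ≈⟨ D⁴-const 1ℤ ⟩
  const 1ℤ                       ∎
  where open ≈-Reasoning

-- Explicit polynomials in `u` and `τ` rather than `inv`: from `τ (1 - u⁴) = 1`, the inverse of
-- `1 - u` is `(1 + u)(1 + u²) τ`.
[1-u]⁻¹ [1+u]⁻¹ : PowerSeries
[1-u]⁻¹ = (const 1ℤ ⊕ u) · (const 1ℤ ⊕ u · u) · τ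
[1+u]⁻¹ = (const 1ℤ ⊝ u) · (const 1ℤ ⊕ u · u) · τ

[1-u]-inverse : (const 1ℤ ⊝ u) · [1-u]⁻¹ ≈ const 1ℤ
[1-u]-inverse = ≈-trans (solve 2 (λ u τ → (con 1ℤ :- u) :* ((con 1ℤ :+ u) :* (con 1ℤ :+ u :* u) :* τ)
  := τ :* (con 1ℤ :- (u :* u) :* (u :* u))) ≈-refl u τ) τ[1-u⁴]

[1+u]-inverse : (const 1ℤ ⊕ u) · [1+u]⁻¹ ≈ const 1ℤ
[1+u]-inverse = ≈-trans (solve 2 (λ u τ → (con 1ℤ :+ u) :* ((con 1ℤ :- u) :* (con 1ℤ :+ u :* u) :* τ)
  := τ :* (con 1ℤ :- (u :* u) :* (u :* u))) ≈-refl u τ) τ[1-u⁴]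

t[1-u]⁴ : t · quad (const 1ℤ ⊝ u) ≈ quad (const 1ℤ ⊕ u)
t[1-u]⁴ = cancel (quad a) (Monic-quad a Monic-φ) (begin
  quad a · (t · quad (const 1ℤ ⊝ u))  ≈⟨ solve 3 (λ x y z → x :* (y :* z) := y :* (x :* z)) ≈-refl (quad a) t (quad (const 1ℤ ⊝ u)) ⟩
  t · (quad a · quad (const 1ℤ ⊝ u))  ≈⟨ ·-congˡ t (quad-· a (const 1ℤ ⊝ u)) ⟨
  t · quad (a · (const 1ℤ ⊝ u))       ≈⟨ ·-congˡ t (quad-cong c≈a[1-u]) ⟨
  t · quad c                          ≈⟨ t·c⁴ ⟩
  quad φ                              ≈⟨ quad-cong φ≈a[1+u] ⟩
  quad (a · (const 1ℤ ⊕ u))           ≈⟨ quad-· a (const 1ℤ ⊕ u) ⟩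
  quad a · quad (const 1ℤ ⊕ u)        ∎)
  where
  open ≈-Reasoning
  Monic-quad : ∀ f → Monic f → Monic (quad f)
  Monic-quad f f₀ = Monic-· (f · f) (f · f) (Monic-· f f f₀ f₀) (Monic-· f f f₀ f₀)

divide : ∀ {x d e y} → x · quad d ≈ y → d · e ≈ const 1ℤ → x ≈ y · quad e
divide {x} {d} {e} {y} p r = begin
  x                        ≈⟨ solve 1 (λ x → x := x :* con 1ℤ) ≈-refl x ⟩
  x · const 1ℤ             ≈⟨ ·-congˡ x (quad-1 r) ⟨
  x · quad (d · e)         ≈⟨ ·-congˡ x (quad-· d e) ⟩
  x · (quad d · quad e)    ≈⟨ solve 3 (λ x d e → x :* (d :* e) := x :* d :* e) ≈-refl x (quad d) (quad e) ⟩
  x · quad d · quad e      ≈⟨ ·-congʳ (quad e) p ⟩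
  y · quad e               ∎
  where open ≈-Reasoning

t-in-u : t ≈ quad (const 1ℤ ⊕ u) · quad [1-u]⁻¹
t-in-u = divide t[1-u]⁴ [1-u]-inverse

t⁻¹-in-u : t⁻¹ ≈ quad (const 1ℤ ⊝ u) · quad [1+u]⁻¹
t⁻¹-in-u = divide (begin
  t⁻¹ · quad (const 1ℤ ⊕ u)         ≈⟨ ·-congˡ t⁻¹ t[1-u]⁴ ⟨
  t⁻¹ · (t · quad (const 1ℤ ⊝ u))   ≈⟨ solve 3 (λ i t x → i :* (t :* x) := t :* i :* x) ≈-refl t⁻¹ t (quad (const 1ℤ ⊝ u)) ⟩
  t · t⁻¹ · quad (const 1ℤ ⊝ u)     ≈⟨ ·-congʳ _ t·t⁻¹ ⟩
  const 1ℤ · quad (const 1ℤ ⊝ u)    ≈⟨ solve 1 (λ x → con 1ℤ :* x := x) ≈-refl (quad (const 1ℤ ⊝ u)) ⟩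
  quad (const 1ℤ ⊝ u)               ∎) [1+u]-inverse
  where open ≈-Reasoning

-- The 8 gained at each step comes from `(1 + u)⁴ - (1 - u)⁴ = 8u(1 + u²)`; the factor `u` beside it
-- is what `U-φz` exploits.
z-in-u : z ≈ const (+ 8) · u · (const 1ℤ ⊕ u · u) · quad [1-u]⁻¹
z-in-u = divide (begin
  z · quad (const 1ℤ ⊝ u)
    ≈⟨ solve 2 (λ t x → (t :- con 1ℤ) :* x := t :* x :- x) ≈-refl t (quad (const 1ℤ ⊝ u)) ⟩
  t · quad (const 1ℤ ⊝ u) ⊝ quad (const 1ℤ ⊝ u)
    ≈⟨ ⊝-cong t[1-u]⁴ ≈-refl ⟩
  quad (const 1ℤ ⊕ u) ⊝ quad (const 1ℤ ⊝ u)
    ≈⟨ solve 1 (λ u → ((con 1ℤ :+ u) :* (con 1ℤ :+ u)) :* ((con 1ℤ :+ u) :* (con 1ℤ :+ u))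
                   :- ((con 1ℤ :- u) :* (con 1ℤ :- u)) :* ((con 1ℤ :- u) :* (con 1ℤ :- u))
         := con (+ 8) :* u :* (con 1ℤ :+ u :* u)) ≈-refl u ⟩
  const (+ 8) · u · (const 1ℤ ⊕ u · u) ∎) [1-u]-inverse
  where open ≈-Reasoning

-- Jacobi's identity divided by `c⁴`, where `β = 2β′` contributes `2⁴`.
z≈16 : z ≈ const (+ 16) · (q · quad β′ · quad c⁻¹)
z≈16 = begin
  z
    ≈⟨ divide (begin
         z · quad c           ≈⟨ solve 2 (λ t x → (t :- con 1ℤ) :* x := t :* x :- x) ≈-refl t (quad c) ⟩
         t · quad c ⊝ quad c  ≈⟨ ⊝-cong t·c⁴ ≈-refl ⟩
         quad φ ⊝ quad c      ≈⟨ jacobi ⟩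
         q · quad β           ∎) (≈-trans (·-comm c c⁻¹) (inv-inverse c Monic-c)) ⟩
  q · quad (const (+ 2) · β′) · quad c⁻¹
    ≈⟨ solve 3 (λ q b i → q :* (((con (+ 2) :* b) :* (con (+ 2) :* b)) :* ((con (+ 2) :* b) :* (con (+ 2) :* b))) :* i
         := con (+ 16) :* (q :* ((b :* b) :* (b :* b)) :* i)) ≈-refl q β′ (quad c⁻¹) ⟩
  const (+ 16) · (q · quad β′ · quad c⁻¹) ∎
  where open ≈-Reasoning

-- Coordinates along 1, u, u², u³ over the series in q⁴

expansion : PowerSeries → PowerSeries → PowerSeries → PowerSeries → PowerSeries
expansion x₀ x₁ x₂ x₃ = D⁴ x₀ ⊕ u · D⁴ x₁ ⊕ u · u · D⁴ x₂ ⊕ u · u · u · D⁴ x₃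

U-expansion : ∀ x₀ x₁ x₂ x₃ → U (expansion x₀ x₁ x₂ x₃) ≈ x₀
U-expansion x₀ x₁ x₂ x₃ = ≈-trans (U-cong (begin
  expansion x₀ x₁ x₂ x₃
    ≈⟨ solve 6 (λ q n a b c d → a :+ q :* n :* b :+ q :* n :* (q :* n) :* c :+ q :* n :* (q :* n) :* (q :* n) :* d
          := a :+ q :* (n :* b) :+ q :* q :* (n :* (n :* c)) :+ q :* q :* q :* (n :* (n :* (n :* d))))
         ≈-refl q (D⁴ ν) (D⁴ x₀) (D⁴ x₁) (D⁴ x₂) (D⁴ x₃) ⟩
  D⁴ x₀ ⊕ q · (D⁴ ν · D⁴ x₁) ⊕ q · q · (D⁴ ν · (D⁴ ν · D⁴ x₂)) ⊕ q · q · q · (D⁴ ν · (D⁴ ν · (D⁴ ν · D⁴ x₃)))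
    ≈⟨ ⊕-cong (⊕-cong (⊕-cong ≈-refl (·-congˡ q (ν· ≈-refl))) (·-congˡ _ (ν· (ν· ≈-refl)))) (·-congˡ _ (ν· (ν· (ν· ≈-refl)))) ⟩
  D⁴ x₀ ⊕ q · D⁴ (ν · x₁) ⊕ q · q · D⁴ (ν · (ν · x₂)) ⊕ q · q · q · D⁴ (ν · (ν · (ν · x₃))) ∎))
  (U-4-dissection x₀ (ν · x₁) (ν · (ν · x₂)) (ν · (ν · (ν · x₃))))
  where
  open ≈-Reasoning
  ν· : ∀ {f g} → f ≈ D⁴ g → D⁴ ν · f ≈ D⁴ (ν · g)
  ν· {f} {g} p = ≈-trans (·-congˡ (D⁴ ν) p) (≈-sym (D⁴-· ν g))

D⁴·expansion : ∀ f x₀ x₁ x₂ x₃ → D⁴ f · expansion x₀ x₁ x₂ x₃ ≈ expansion (f · x₀) (f · x₁) (f · x₂) (f · x₃)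
D⁴·expansion f x₀ x₁ x₂ x₃ = ≈-trans
  (solve 6 (λ f u a b c d → f :* (a :+ u :* b :+ u :* u :* c :+ u :* u :* u :* d)
      := f :* a :+ u :* (f :* b) :+ u :* u :* (f :* c) :+ u :* u :* u :* (f :* d)) ≈-refl
      (D⁴ f) u (D⁴ x₀) (D⁴ x₁) (D⁴ x₂) (D⁴ x₃))
  (≈-sym (⊕-cong (⊕-cong (⊕-cong (D⁴-· f x₀) (·-congˡ u (D⁴-· f x₁))) (·-congˡ _ (D⁴-· f x₂))) (·-congˡ _ (D⁴-· f x₃))))

-- A cyclic shift of the coordinates, in which the last one picks up `u⁴ = D⁴ w`.
u·expansion : ∀ x₀ x₁ x₂ x₃ → u · expansion x₀ x₁ x₂ x₃ ≈ expansion (w · x₃) x₀ x₁ x₂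
u·expansion x₀ x₁ x₂ x₃ = ≈-trans
  (solve 5 (λ u a b c d → u :* (a :+ u :* b :+ u :* u :* c :+ u :* u :* u :* d)
      := (u :* u) :* (u :* u) :* d :+ u :* a :+ u :* u :* b :+ u :* u :* u :* c) ≈-refl
      u (D⁴ x₀) (D⁴ x₁) (D⁴ x₂) (D⁴ x₃))
  (⊕-cong (⊕-cong (⊕-cong (≈-trans (·-congʳ (D⁴ x₃) u⁴) (≈-sym (D⁴-· w x₃))) ≈-refl) ≈-refl) ≈-refl)

-- The subring ℤ[t, t⁻¹]
data Laurent : PowerSeries → Set where
  one  : Laurent (const 1ℤ)
  add  : ∀ {f g} → Laurent f → Laurent g → Laurent (f ⊕ g)
  neg  : ∀ {f} → Laurent f → Laurent (⊖ f)
  t·_  : ∀ {f} → Laurent f → Laurent (t · f)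
  t⁻¹·_ : ∀ {f} → Laurent f → Laurent (t⁻¹ · f)

-- `Laurent` has no closure under `_≈_`, so zero appears in a form that the constructors produce.
Laurent-zero : Laurent (const 1ℤ ⊝ const 1ℤ)
Laurent-zero = add one (neg one)

-- The coordinates lie in ℤ[t, t⁻¹] again, which is what allows `U` to be iterated.
record Expands (f : PowerSeries) : Set where
  constructor expands
  field
    {x₀ x₁ x₂ x₃} : PowerSeries
    in₀ : Laurent x₀
    in₁ : Laurent x₁
    in₂ : Laurent x₂
    in₃ : Laurent x₃
    eq  : f ≈ expansion x₀ x₁ x₂ x₃

Expands-resp : ∀ {f g} → f ≈ g → Expands f → Expands g
Expands-resp p (expands i₀ i₁ i₂ i₃ eq) = expands i₀ i₁ i₂ i₃ (≈-trans (≈-sym p) eq)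

Expands-one : Expands (const 1ℤ)
Expands-one = expands one Laurent-zero Laurent-zero Laurent-zero (≈-sym (begin
  expansion (const 1ℤ) 0′ 0′ 0′
    ≈⟨ ⊕-cong (⊕-cong (⊕-cong (D⁴-const 1ℤ) (·-congˡ _ D⁴-0′)) (·-congˡ _ D⁴-0′)) (·-congˡ _ D⁴-0′) ⟩
  const 1ℤ ⊕ u · const 0ℤ ⊕ u · u · const 0ℤ ⊕ u · u · u · const 0ℤ
    ≈⟨ solve 1 (λ u → con 1ℤ :+ u :* con 0ℤ :+ u :* u :* con 0ℤ :+ u :* u :* u :* con 0ℤ := con 1ℤ) ≈-refl u ⟩
  const 1ℤ ∎))
  where
  open ≈-Reasoning
  0′ : PowerSeries
  0′ = const 1ℤ ⊝ const 1ℤ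
  D⁴-0′ : D⁴ 0′ ≈ const 0ℤ
  D⁴-0′ = ≈-trans (D⁴-cong (solve 0 (con 1ℤ :- con 1ℤ := con 0ℤ) ≈-refl)) (D⁴-const 0ℤ)

Expands-add : ∀ {f g} → Expands f → Expands g → Expands (f ⊕ g)
Expands-add (expands {x₀} {x₁} {x₂} {x₃} i₀ i₁ i₂ i₃ p) (expands {y₀} {y₁} {y₂} {y₃} j₀ j₁ j₂ j₃ r) =
  expands (add i₀ j₀) (add i₁ j₁) (add i₂ j₂) (add i₃ j₃) (≈-trans (⊕-cong p r) (≈-trans
    (solve 9 (λ u a b c d a′ b′ c′ d′ →
        (a :+ u :* b :+ u :* u :* c :+ u :* u :* u :* d) :+ (a′ :+ u :* b′ :+ u :* u :* c′ :+ u :* u :* u :* d′)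
        := (a :+ a′) :+ u :* (b :+ b′) :+ u :* u :* (c :+ c′) :+ u :* u :* u :* (d :+ d′)) ≈-refl
      u (D⁴ x₀) (D⁴ x₁) (D⁴ x₂) (D⁴ x₃) (D⁴ y₀) (D⁴ y₁) (D⁴ y₂) (D⁴ y₃))
    (≈-sym (⊕-cong (⊕-cong (⊕-cong (D⁴-⊕ x₀ y₀) (·-congˡ _ (D⁴-⊕ x₁ y₁))) (·-congˡ _ (D⁴-⊕ x₂ y₂))) (·-congˡ _ (D⁴-⊕ x₃ y₃))))))

Expands-neg : ∀ {f} → Expands f → Expands (⊖ f)
Expands-neg (expands {x₀} {x₁} {x₂} {x₃} i₀ i₁ i₂ i₃ p) =
  expands (neg i₀) (neg i₁) (neg i₂) (neg i₃) (≈-trans (⊖-cong p) (≈-trans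
    (solve 5 (λ u a b c d → :- (a :+ u :* b :+ u :* u :* c :+ u :* u :* u :* d)
        := (:- a) :+ u :* (:- b) :+ u :* u :* (:- c) :+ u :* u :* u :* (:- d)) ≈-refl
      u (D⁴ x₀) (D⁴ x₁) (D⁴ x₂) (D⁴ x₃))
    (≈-sym (⊕-cong (⊕-cong (⊕-cong (D⁴-⊖ x₀) (·-congˡ _ (D⁴-⊖ x₁))) (·-congˡ _ (D⁴-⊖ x₂))) (·-congˡ _ (D⁴-⊖ x₃))))))

-- Multipliers are closed under the ring operations, so the cases `u` and `τ` cover every polynomial
-- in them, and two general expansions never have to be multiplied.
Multiplier : PowerSeries → Set
Multiplier m = ∀ {f} → Expands f → Expands (m · f)

u-multiplier : Multiplier u
u-multiplier (expands {x₀} {x₁} {x₂} {x₃} i₀ i₁ i₂ i₃ p) =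
  -- `w · x₃` is spelled `x₃ - t⁻¹ x₃`, which the constructors of `Laurent` can build.
  expands (add i₃ (neg (t⁻¹· i₃))) i₀ i₁ i₂ (≈-trans (·-congˡ u p) (≈-trans (u·expansion x₀ x₁ x₂ x₃)
    (⊕-cong (⊕-cong (⊕-cong (D⁴-cong
      (solve 2 (λ i x → (con 1ℤ :- i) :* x := x :- i :* x) ≈-refl t⁻¹ x₃)) ≈-refl) ≈-refl) ≈-refl)))

τ-multiplier : Multiplier τ
τ-multiplier (expands {x₀} {x₁} {x₂} {x₃} i₀ i₁ i₂ i₃ p) =
  expands (t· i₀) (t· i₁) (t· i₂) (t· i₃) (≈-trans (·-congˡ τ p) (D⁴·expansion t x₀ x₁ x₂ x₃))

1-multiplier : Multiplier (const 1ℤ)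
1-multiplier {f} e = Expands-resp (solve 1 (λ f → f := con 1ℤ :* f) ≈-refl f) e

⊕-multiplier : ∀ {m n} → Multiplier m → Multiplier n → Multiplier (m ⊕ n)
⊕-multiplier {m} {n} M M′ {f} e =
  Expands-resp (solve 3 (λ m n f → m :* f :+ n :* f := (m :+ n) :* f) ≈-refl m n f) (Expands-add (M e) (M′ e))

⊖-multiplier : ∀ {m} → Multiplier m → Multiplier (⊖ m)
⊖-multiplier {m} M {f} e =
  Expands-resp (solve 2 (λ m f → :- (m :* f) := (:- m) :* f) ≈-refl m f) (Expands-neg (M e))

·-multiplier : ∀ {m n} → Multiplier m → Multiplier n → Multiplier (m · n)
·-multiplier {m} {n} M M′ {f} e =
  Expands-resp (solve 3 (λ m n f → m :* (n :* f) := m :* n :* f) ≈-refl m n f) (M (M′ e))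

quad-multiplier : ∀ {m} → Multiplier m → Multiplier (quad m)
quad-multiplier {m} M = ·-multiplier {m · m} {m · m} (·-multiplier {m} {m} M M) (·-multiplier {m} {m} M M)

1+u-multiplier : Multiplier (const 1ℤ ⊕ u)
1+u-multiplier = ⊕-multiplier {const 1ℤ} {u} 1-multiplier u-multiplier

1-u-multiplier : Multiplier (const 1ℤ ⊝ u)
1-u-multiplier = ⊕-multiplier {const 1ℤ} {⊖ u} 1-multiplier (⊖-multiplier {u} u-multiplier)

1+u²-multiplier : Multiplier (const 1ℤ ⊕ u · u)
1+u²-multiplier = ⊕-multiplier {const 1ℤ} {u · u} 1-multiplier (·-multiplier {u} {u} u-multiplier u-multiplier)

[1-u]⁻¹-multiplier : Multiplier [1-u]⁻¹
[1-u]⁻¹-multiplier = ·-multiplier {(const 1ℤ ⊕ u) · (const 1ℤ ⊕ u · u)} {τ}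
  (·-multiplier {const 1ℤ ⊕ u} {const 1ℤ ⊕ u · u} 1+u-multiplier 1+u²-multiplier) τ-multiplier

[1+u]⁻¹-multiplier : Multiplier [1+u]⁻¹
[1+u]⁻¹-multiplier = ·-multiplier {(const 1ℤ ⊝ u) · (const 1ℤ ⊕ u · u)} {τ}
  (·-multiplier {const 1ℤ ⊝ u} {const 1ℤ ⊕ u · u} 1-u-multiplier 1+u²-multiplier) τ-multiplier

-- `t` and `t⁻¹` act as `((1 + u)/(1 - u))⁴` and its reciprocal, both polynomials in `u` and `τ`.
Laurent⇒Expands : ∀ {f} → Laurent f → Expands f
Laurent⇒Expands one = Expands-one
Laurent⇒Expands (add i j) = Expands-add (Laurent⇒Expands i) (Laurent⇒Expands j)
Laurent⇒Expands (neg i) = Expands-neg (Laurent⇒Expands i)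
Laurent⇒Expands (t·_ {f} i) = Expands-resp (·-congʳ f (≈-sym t-in-u))
  (·-multiplier {quad (const 1ℤ ⊕ u)} {quad [1-u]⁻¹} (quad-multiplier {const 1ℤ ⊕ u} 1+u-multiplier) (quad-multiplier {[1-u]⁻¹} [1-u]⁻¹-multiplier) (Laurent⇒Expands i))
Laurent⇒Expands (t⁻¹·_ {f} i) = Expands-resp (·-congʳ f (≈-sym t⁻¹-in-u))
  (·-multiplier {quad (const 1ℤ ⊝ u)} {quad [1+u]⁻¹} (quad-multiplier {const 1ℤ ⊝ u} 1-u-multiplier) (quad-multiplier {[1+u]⁻¹} [1+u]⁻¹-multiplier) (Laurent⇒Expands i))

-- The action of U on φ, φ z ℤ[t, t⁻¹] and G

U-φ : U φ ≈ φ
U-φ = begin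
  U φ                              ≈⟨ U-cong φ-dissection ⟩
  U (D⁴ φ ⊕ q · D⁴ β)              ≈⟨ ev-cong (ev-Dq (D φ) (D β)) ⟩
  ev (D φ)                         ≈⟨ ev-D φ ⟩
  φ                                ∎
  where open ≈-Reasoning

-- `φ z f = 8 a u (m f)`, where `m` is what `z-in-u` leaves after `8u`, times `1 + u`. The single
-- `u` moves the last coordinate `x₃` of `m f` to the first place as `w x₃ = z (t⁻¹ x₃)`, so `z`
-- returns and `t⁻¹ x₃` is the new cofactor; `a = D⁴ φ` leaves `U` as `φ`.
U-φz : ∀ {f} → Laurent f → ∃[ g ] (Laurent g × U (φ · z · f) ≈ const (+ 8) · (φ · z · g))
U-φz {f} i = contract (m-multiplier (Laurent⇒Expands i))
  where
  open ≈-Reasoning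
  m : PowerSeries
  m = (const 1ℤ ⊕ u) · ((const 1ℤ ⊕ u · u) · quad [1-u]⁻¹)
  m-multiplier : Multiplier m
  m-multiplier = ·-multiplier {const 1ℤ ⊕ u} {(const 1ℤ ⊕ u · u) · quad [1-u]⁻¹} 1+u-multiplier
    (·-multiplier {const 1ℤ ⊕ u · u} {quad [1-u]⁻¹} 1+u²-multiplier (quad-multiplier {[1-u]⁻¹} [1-u]⁻¹-multiplier))
  contract : Expands (m · f) → ∃[ g ] (Laurent g × U (φ · z · f) ≈ const (+ 8) · (φ · z · g))
  contract (expands {x₀} {x₁} {x₂} {x₃} i₀ i₁ i₂ i₃ p) = t⁻¹ · x₃ , t⁻¹· i₃ , (begin
    U (φ · z · f)
      ≈⟨ U-cong (·-congʳ f (·-cong φ≈a[1+u] z-in-u)) ⟩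
    U (a · (const 1ℤ ⊕ u) · (const (+ 8) · u · (const 1ℤ ⊕ u · u) · quad [1-u]⁻¹) · f)
      ≈⟨ U-cong (solve 5 (λ a u v i f → a :* (con 1ℤ :+ u) :* (con (+ 8) :* u :* v :* i) :* f
            := con (+ 8) :* (a :* (u :* ((con 1ℤ :+ u) :* (v :* i) :* f)))) ≈-refl a u (const 1ℤ ⊕ u · u) (quad [1-u]⁻¹) f) ⟩
    U (const (+ 8) · (a · (u · ((const 1ℤ ⊕ u) · ((const 1ℤ ⊕ u · u) · quad [1-u]⁻¹) · f))))
      ≈⟨ U-scale (+ 8) _ ⟩
    const (+ 8) · U (a · (u · ((const 1ℤ ⊕ u) · ((const 1ℤ ⊕ u · u) · quad [1-u]⁻¹) · f)))
      ≈⟨ ·-congˡ _ (U-cong (·-congˡ a (·-congˡ u p))) ⟩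
    const (+ 8) · U (a · (u · expansion x₀ x₁ x₂ x₃))
      ≈⟨ ·-congˡ _ (U-cong (≈-trans (·-congˡ a (u·expansion x₀ x₁ x₂ x₃)) (D⁴·expansion φ (w · x₃) x₀ x₁ x₂))) ⟩
    const (+ 8) · U (expansion (φ · (w · x₃)) (φ · x₀) (φ · x₁) (φ · x₂))
      ≈⟨ ·-congˡ _ (U-expansion (φ · (w · x₃)) (φ · x₀) (φ · x₁) (φ · x₂)) ⟩
    const (+ 8) · (φ · (w · x₃))
      ≈⟨ ·-congˡ _ (·-congˡ φ (·-congʳ x₃ t⁻¹·z)) ⟨
    const (+ 8) · (φ · (t⁻¹ · z · x₃))
      ≈⟨ ·-congˡ _ (solve 4 (λ p i z x → p :* (i :* z :* x) := p :* z :* (i :* x)) ≈-refl φ t⁻¹ z x₃) ⟩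
    const (+ 8) · (φ · z · (t⁻¹ · x₃)) ∎)

G-in-u : G ≈ a · (const 1ℤ ⊕ u) · (const 1ℤ ⊕ u) · [1-u]⁻¹
G-in-u = cancel c Monic-c (begin
  c · G
    ≈⟨ c·G ⟩
  φ · φ
    ≈⟨ ·-cong φ≈a[1+u] φ≈a[1+u] ⟩
  a · (const 1ℤ ⊕ u) · (a · (const 1ℤ ⊕ u))
    ≈⟨ solve 2 (λ a v → a :* v :* (a :* v) := a :* (a :* v :* v :* con 1ℤ)) ≈-refl a (const 1ℤ ⊕ u) ⟩
  a · (a · (const 1ℤ ⊕ u) · (const 1ℤ ⊕ u) · const 1ℤ)
    ≈⟨ ·-congˡ a (·-congˡ _ [1-u]-inverse) ⟨
  a · (a · (const 1ℤ ⊕ u) · (const 1ℤ ⊕ u) · ((const 1ℤ ⊝ u) · [1-u]⁻¹))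
    ≈⟨ solve 4 (λ a v m i → a :* (a :* v :* v :* (m :* i)) := a :* m :* (a :* v :* v :* i)) ≈-refl a (const 1ℤ ⊕ u) (const 1ℤ ⊝ u) [1-u]⁻¹ ⟩
  a · (const 1ℤ ⊝ u) · (a · (const 1ℤ ⊕ u) · (const 1ℤ ⊕ u) · [1-u]⁻¹)
    ≈⟨ ·-congʳ _ c≈a[1-u] ⟨
  c · (a · (const 1ℤ ⊕ u) · (const 1ℤ ⊕ u) · [1-u]⁻¹) ∎)
  where open ≈-Reasoning

U-G : U G ≈ φ ⊕ const (+ 4) · (φ · z)
U-G = begin
  U G
    ≈⟨ U-cong G-in-u ⟩
  U (a · (const 1ℤ ⊕ u) · (const 1ℤ ⊕ u) · [1-u]⁻¹)
    -- `(1 + u)³(1 + u²) = 1 + 3u + 4u² + 4u³ + 3u⁴ +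
    -- u⁵`, grouped by exponents of `u` modulo 4; only the group `1 + 3u⁴` survives `U`.
    ≈⟨ U-cong (solve 3 (λ a u τ → a :* (con 1ℤ :+ u) :* (con 1ℤ :+ u) :* ((con 1ℤ :+ u) :* (con 1ℤ :+ u :* u) :* τ)
          := a :* τ :* ((con 1ℤ :+ con (+ 3) :* ((u :* u) :* (u :* u))) :+ u :* (con (+ 3) :+ (u :* u) :* (u :* u))
                         :+ u :* u :* con (+ 4) :+ u :* u :* u :* con (+ 4))) ≈-refl a u τ) ⟩
  U (a · τ · (const 1ℤ ⊕ const (+ 3) · quad u ⊕ u · (const (+ 3) ⊕ quad u) ⊕ u · u · const (+ 4) ⊕ u · u · u · const (+ 4)))
    ≈⟨ U-cong (·-cong (≈-sym (D⁴-· φ t)) (⊕-cong (⊕-cong (⊕-cong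
          (≈-trans (⊕-cong (≈-sym (D⁴-const 1ℤ)) (≈-trans (·-cong (≈-sym (D⁴-const (+ 3))) u⁴) (≈-sym (D⁴-· (const (+ 3)) w))))
                   (≈-sym (D⁴-⊕ (const 1ℤ) (const (+ 3) · w))))
          (·-congˡ u (≈-trans (⊕-cong (≈-sym (D⁴-const (+ 3))) u⁴) (≈-sym (D⁴-⊕ (const (+ 3)) w)))))
          (·-congˡ _ (≈-sym (D⁴-const (+ 4))))) (·-congˡ _ (≈-sym (D⁴-const (+ 4)))))) ⟩
  U (D⁴ (φ · t) · expansion y₀ y₁ (const (+ 4)) (const (+ 4)))
    ≈⟨ U-cong (D⁴·expansion (φ · t) y₀ y₁ (const (+ 4)) (const (+ 4))) ⟩
  U (expansion (φ · t · y₀) (φ · t · y₁) (φ · t · const (+ 4)) (φ · t · const (+ 4)))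
    ≈⟨ U-expansion (φ · t · y₀) (φ · t · y₁) (φ · t · const (+ 4)) (φ · t · const (+ 4)) ⟩
  φ · t · (const 1ℤ ⊕ const (+ 3) · w)
    ≈⟨ solve 3 (λ p t w → p :* t :* (con 1ℤ :+ con (+ 3) :* w) := p :* (t :+ con (+ 3) :* (t :* w))) ≈-refl φ t w ⟩
  φ · (t ⊕ const (+ 3) · (t · w))
    ≈⟨ ·-congˡ φ (⊕-cong ≈-refl (·-congˡ _ t·w)) ⟩
  φ · (t ⊕ const (+ 3) · z)
    ≈⟨ solve 2 (λ p t → p :* (t :+ con (+ 3) :* (t :- con 1ℤ)) := p :+ con (+ 4) :* (p :* (t :- con 1ℤ))) ≈-refl φ t ⟩
  φ ⊕ const (+ 4) · (φ · z) ∎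
  where
  open ≈-Reasoning
  y₀ y₁ : PowerSeries
  y₀ = const 1ℤ ⊕ const (+ 3) · w
  y₁ = const (+ 3) ⊕ w

-- Iterates of U and the power of 2

U^ : ℕ → PowerSeries → PowerSeries
U^ zero    f = f
U^ (suc k) f = U (U^ k f)

-- The 4 is that of `U-G`, and every further step contributes the 8 of `U-φz`. Membership of `f` in
-- `Laurent` is kept as the induction hypothesis for the next step.
U^-G : ∀ k → ∃[ f ] (Laurent f × U^ (suc k) G ≈ φ ⊕ const (+ (4 * 8 ^ k)) · (φ · z · f))
U^-G zero    = const 1ℤ , one , ≈-trans U-G (⊕-cong ≈-refl (·-congˡ _ (solve 1 (λ x → x := x :* con 1ℤ) ≈-refl (φ · z))))
U^-G (suc k) = let f , i , p = U^-G k; g , j , r = U-φz i in g , j , (begin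
  U (U^ (suc k) G)
    ≈⟨ U-cong p ⟩
  U (φ ⊕ const (+ (4 * 8 ^ k)) · (φ · z · f))
    ≈⟨ ≈-trans (U-⊕ φ (const (+ (4 * 8 ^ k)) · (φ · z · f))) (⊕-cong U-φ (U-scale (+ (4 * 8 ^ k)) (φ · z · f))) ⟩
  φ ⊕ const (+ (4 * 8 ^ k)) · U (φ · z · f)
    ≈⟨ ⊕-cong ≈-refl (·-congˡ _ r) ⟩
  φ ⊕ const (+ (4 * 8 ^ k)) · (const (+ 8) · (φ · z · g))
    ≈⟨ ⊕-cong ≈-refl (solve 3 (λ x y g → x :* (y :* g) := x :* y :* g) ≈-refl (const (+ (4 * 8 ^ k))) (const (+ 8)) (φ · z · g)) ⟩
  φ ⊕ const (+ (4 * 8 ^ k)) · const (+ 8) · (φ · z · g)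
    ≈⟨ ⊕-cong ≈-refl (·-congʳ _ (≈-trans (≈-sym (const-* (+ (4 * 8 ^ k)) (+ 8))) const-8^)) ⟩
  φ ⊕ const (+ (4 * 8 ^ suc k)) · (φ · z · g) ∎)
  where
  open ≈-Reasoning
  const-8^ : const (+ (4 * 8 ^ k) ℤ.* + 8) ≈ const (+ (4 * 8 ^ suc k))
  const-8^ = mk≈ λ i → cong (λ x → const x i) (trans (sym (ℤ.pos-* (4 * 8 ^ k) 8))
    (cong (λ m → + m) (trans (ℕ.*-assoc 4 (8 ^ k) 8) (cong (4 *_) (ℕ.*-comm (8 ^ k) 8)))))

U^-cong : ∀ k {f g} → f ≈ g → U^ k f ≈ U^ k g
U^-cong zero    p = p
U^-cong (suc k) p = U-cong (U^-cong k p)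

U^-affine : ∀ k f → U^ k (const (+ 2) · f ⊝ const 1ℤ) ≈ const (+ 2) · U^ k f ⊝ const 1ℤ
U^-affine zero    f = ≈-refl
U^-affine (suc k) f = ≈-trans (U-cong (U^-affine k f)) (≈-trans (U-⊕ (const (+ 2) · U^ k f) (⊖ const 1ℤ))
  (⊕-cong (U-scale (+ 2) (U^ k f)) (≈-trans (U-⊖ (const 1ℤ)) (⊖-cong (U-const 1ℤ)))))

U^-shift : ∀ k f → U^ k (U f) ≈ U (U^ k f)
U^-shift zero    f = ≈-refl
U^-shift (suc k) f = U-cong (U^-shift k f)

U^-at : ∀ k f n → U^ k f n ≡ f (2 ^ (2 * k) * n)
U^-at zero    f n = cong f (sym (ℕ.+-identityʳ n))
U^-at (suc k) f n = trans (U^-at k f (double (double n))) (cong f (begin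
  2 ^ (2 * k) * double (double n)   ≡⟨ cong (_*_ (2 ^ (2 * k))) (trans (cong double (sym (2*≡double n))) (sym (2*≡double (2 * n)))) ⟩
  2 ^ (2 * k) * (2 * (2 * n))       ≡⟨ cong (_*_ (2 ^ (2 * k))) (ℕ.*-assoc 2 2 n) ⟨
  2 ^ (2 * k) * (4 * n)             ≡⟨ ℕ.*-assoc (2 ^ (2 * k)) 4 n ⟨
  2 ^ (2 * k) * 4 * n               ≡⟨ cong (_* n) (ℕ.^-distribˡ-+-* 2 (2 * k) 2) ⟨
  2 ^ (2 * k + 2) * n               ≡⟨ cong (λ m → 2 ^ m * n) (trans (ℕ.+-comm (2 * k) 2) (sym (ℕ.*-suc 2 k))) ⟩
  2 ^ (2 * suc k) * n               ∎))
  where open ≡-Reasoning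

G≈2Uv₀-1 : G ≈ const (+ 2) · U v₀ ⊝ const 1ℤ
G≈2Uv₀-1 = ≈-trans (ev-⊕ (const (+ 2) · ev v₀) (⊖ const 1ℤ))
  (⊕-cong (mk≈ λ n → trans (const-·-at (+ 2) (ev v₀) _) (sym (const-·-at (+ 2) (U v₀) n)))
          (≈-trans (ev-⊖ (const 1ℤ)) (⊖-cong (ev-const 1ℤ))))

4·8^k·16 : ∀ k → 4 * 8 ^ k * 16 ≡ 2 * 2 ^ (3 * suc k + 2)
4·8^k·16 k = begin
  4 * 8 ^ k * 16                ≡⟨ cong (λ m → 4 * m * 16) (ℕ.^-*-assoc 2 3 k) ⟩
  2 ^ 2 * 2 ^ (3 * k) * 2 ^ 4   ≡⟨ cong (_* 16) (ℕ.^-distribˡ-+-* 2 2 (3 * k)) ⟨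
  2 ^ (2 + 3 * k) * 2 ^ 4       ≡⟨ ℕ.^-distribˡ-+-* 2 (2 + 3 * k) 4 ⟨
  2 ^ (2 + 3 * k + 4)           ≡⟨ cong (2 ^_) (ℕ.+-comm (2 + 3 * k) 4) ⟩
  2 ^ (3 + (3 + 3 * k))         ≡⟨ cong (λ j → 2 ^ (3 + j)) (ℕ.*-suc 3 k) ⟨
  2 ^ (3 + 3 * suc k)           ≡⟨ cong (λ j → 2 ^ suc j) (ℕ.+-comm 2 (3 * suc k)) ⟩
  2 * 2 ^ (3 * suc k + 2)       ∎
  where open ≡-Reasoning

-- Of the `2 + k` applications of `U`, one leads from `v₀` to `G`, up to the map `x ↦ 2x - 1`, and
-- `k + 1 = α` act on `G`. That map also takes `Θ` to `φ`, so the difference doubles and one power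
-- of 2 is cancelled.
U^v₀ : ∀ k → ∃[ g ] U^ (2 + k) v₀ ⊝ Θ ≈ const (+ (2 ^ (3 * suc k + 2))) · g
U^v₀ k = let f , _ , p = U^-G k in φ · y · f , halve (begin
  const (+ 2) · (U^ (2 + k) v₀ ⊝ Θ)
    ≈⟨ solve 2 (λ x θ → con (+ 2) :* (x :- θ) := (con (+ 2) :* x :- con 1ℤ) :- (con (+ 2) :* θ :- con 1ℤ)) ≈-refl (U^ (2 + k) v₀) Θ ⟩
  (const (+ 2) · U (U^ (suc k) v₀) ⊝ const 1ℤ) ⊝ φ
    ≈⟨ ⊝-cong (⊝-cong (·-congˡ _ (U^-shift (suc k) v₀)) ≈-refl) ≈-refl ⟨
  (const (+ 2) · U^ (suc k) (U v₀) ⊝ const 1ℤ) ⊝ φ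
    ≈⟨ ⊝-cong (U^-affine (suc k) (U v₀)) ≈-refl ⟨
  U^ (suc k) (const (+ 2) · U v₀ ⊝ const 1ℤ) ⊝ φ
    ≈⟨ ⊝-cong (U^-cong (suc k) G≈2Uv₀-1) ≈-refl ⟨
  U^ (suc k) G ⊝ φ
    ≈⟨ ⊝-cong p ≈-refl ⟩
  φ ⊕ const (+ (4 * 8 ^ k)) · (φ · z · f) ⊝ φ
    ≈⟨ ⊝-cong (⊕-cong ≈-refl (·-congˡ _ (·-congʳ f (·-congˡ φ z≈16)))) ≈-refl ⟩
  φ ⊕ const (+ (4 * 8 ^ k)) · (φ · (const (+ 16) · y) · f) ⊝ φ
    ≈⟨ solve 4 (λ x p y f → p :+ x :* (p :* (con (+ 16) :* y) :* f) :- p := x :* con (+ 16) :* (p :* y :* f))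
         ≈-refl (const (+ (4 * 8 ^ k))) φ y f ⟩
  const (+ (4 * 8 ^ k)) · const (+ 16) · (φ · y · f)
    ≈⟨ ·-congʳ _ modulus ⟩
  const (+ 2) · const (+ m) · (φ · y · f)
    ≈⟨ solve 2 (λ m g → con (+ 2) :* m :* g := con (+ 2) :* (m :* g)) ≈-refl (const (+ m)) (φ · y · f) ⟩
  const (+ 2) · (const (+ m) · (φ · y · f)) ∎)
  where
  open ≈-Reasoning
  m : ℕ
  m = 2 ^ (3 * suc k + 2)
  y : PowerSeries
  y = q · quad β′ · quad c⁻¹
  halve : ∀ {f g} → const (+ 2) · f ≈ const (+ 2) · g → f ≈ g
  halve {f} {g} p = mk≈ λ n → ℤ.*-cancelˡ-≡ (+ 2) (f n) (g n)
    (trans (sym (const-·-at (+ 2) f n)) (trans (coeff p n) (const-·-at (+ 2) g n)))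
  modulus : const (+ (4 * 8 ^ k)) · const (+ 16) ≈ const (+ 2) · const (+ m)
  modulus = ≈-trans (≈-sym (const-* (+ (4 * 8 ^ k)) (+ 16))) (≈-trans
    (mk≈ λ i → cong (λ x → const x i)
      (trans (sym (ℤ.pos-* (4 * 8 ^ k) 16)) (trans (cong (λ j → + j) (4·8^k·16 k)) (ℤ.pos-* 2 m))))
    (const-* (+ 2) (+ m)))

v₀≡Θ : ∀ n k → v₀ (2 ^ (2 * suc k + 2) * n) ≡ Θ n [mod 2 ^ (3 * suc k + 2) ]
v₀≡Θ n k = let g , p = U^v₀ k in divides (g n) (begin
  v₀ (2 ^ (2 * suc k + 2) * n) ℤ.- Θ n
    ≡⟨ cong (λ j → v₀ (2 ^ j * n) ℤ.- Θ n) (trans (ℕ.+-comm (2 * suc k) 2) (sym (ℕ.*-suc 2 (suc k)))) ⟩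
  v₀ (2 ^ (2 * (2 + k)) * n) ℤ.- Θ n
    ≡⟨ cong (ℤ._- Θ n) (U^-at (2 + k) v₀ n) ⟨
  U^ (2 + k) v₀ n ℤ.- Θ n
    ≡⟨ cong (ℤ._+_ (U^ (2 + k) v₀ n)) (⊖-at Θ n) ⟨
  U^ (2 + k) v₀ n ℤ.+ (⊖ Θ) n
    ≡⟨ ⊕-at (U^ (2 + k) v₀) (⊖ Θ) n ⟨
  (U^ (2 + k) v₀ ⊝ Θ) n
    ≡⟨ coeff p n ⟩
  (const (+ m) · g) n
    ≡⟨ const-·-at (+ m) g n ⟩
  + m ℤ.* g n
    ≡⟨ ℤ.*-comm (+ m) (g n) ⟩
  g n ℤ.* + m ∎)
  where
  open ≡-Reasoning
  m : ℕ
  m = 2 ^ (3 * suc k + 2)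

theorem1p1 : ∀ (n α : ℕ) → α > 0 →
    (IsSquare n → v₀ (2 ^ (2 * α + 2) * n) ≡ 1ℤ [mod 2 ^ (3 * α + 2) ]) ×
    (¬ IsSquare n → v₀ (2 ^ (2 * α + 2) * n) ≡ 0ℤ [mod 2 ^ (3 * α + 2) ])
theorem1p1 n (suc k) _ =
    (λ sq → subst (λ θ → v₀ (2 ^ (2 * suc k + 2) * n) ≡ θ [mod 2 ^ (3 * suc k + 2) ]) (Θ-square (IsSquare⇒Square sq)) (v₀≡Θ n k))
  , (λ ¬sq → subst (λ θ → v₀ (2 ^ (2 * suc k + 2) * n) ≡ θ [mod 2 ^ (3 * suc k + 2) ]) (Θ-nonsquare (¬sq ∘ Square⇒IsSquare)) (v₀≡Θ n k))
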